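{- Let $G$ be a simple game with $n$ players. Then $G$ is roughly weighted if and only if $G$ has the at-least-half property of degree $(n+1)2^{\frac{1}{2}n\log_2 n}$.
   Context: A simple game is $G=(P,W)$ with $P=[n]$, $W\subseteq 2^P$ (winning coalitions) closed under supersets within $P$, $W\ne\emptyset$, $W\ne 2^P$; other coalitions are losing. $G$ is roughly weighted if there exist non-negative reals $w_1,\dots,w_n$ and a real $q$, not all zero, such that $\sum_{i\in X}w_i<q$ implies $X$ losing and $\sum_{i\in X}w_i>q$ implies $X$ winning. A coalition is blocking if it is the complement of a losing coalition. A sequence of coalitions $(Z_1,\dots,Z_{2k})$ is an EL sequence of degree $k$ if half of its coalitions are winning and half are blocking. $G$ has the at-least-half property of degree $k$ if every EL sequence of degree $k$ or less has some player occurring in at least half of the coalitions of the sequence.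
   Formalization: The weights w_1,…,w_n and the quota q in the definition of "roughly weighted" are taken to be rational numbers instead of real numbers. -}

module Defs where

open import Data.Nat using (ℕ; zero; suc; _*_; _^_) renaming (_≤_ to _≤ℕ_; _+_ to _+ℕ_)
open import Data.Bool using (Bool; true; false; if_then_else_)
open import Data.Fin using (Fin; zero; suc)
open import Data.Fin.Subset using (Subset; _⊆_; ∁; _∈_)
open import Data.Fin.Subset.Properties using (_∈?_)
open import Data.Vec using (Vec; []; _∷_)
open import Data.Vec.Relation.Unary.All using (All)
open import Data.Product using (∃; _×_)
open import Data.Rational using (ℚ; 0ℚ; _+_; _<_; _>_; _≤_)
open import Relation.Binary.PropositionalEquality using (_≡_)
open import Relation.Nullary using (¬_; yes; no)

-- A simple game on the player set P = Fin n (i.e. [n]).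
-- Coalitions are subsets of Fin n; W is given by its (Boolean) characteristic
-- function `win` (every subset of the finite set 2^P is decidable).
record SimpleGame (n : ℕ) : Set where
  field
    win       : Subset n → Bool
    monotone  : ∀ (X Y : Subset n) → X ⊆ Y → win X ≡ true → win Y ≡ true
    nonEmpty  : ∃ λ (X : Subset n) → win X ≡ true
    notAll    : ∃ λ (X : Subset n) → win X ≡ false

module _ {n : ℕ} (G : SimpleGame n) where
  open SimpleGame G

  Winning : Subset n → Set
  Winning X = win X ≡ true

  Losing : Subset n → Set
  Losing X = win X ≡ false

  Blocking : Subset n → Set
  Blocking X = Losing (∁ X)

weight : {n : ℕ} → (Fin n → ℚ) → Subset n → ℚ
weight {zero}  w []      = 0ℚ
weight {suc n} w (b ∷ X) = (if b then w zero else 0ℚ) + weight (λ i → w (suc i)) X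

RoughlyWeighted : {n : ℕ} → SimpleGame n → Set
RoughlyWeighted {n} G =
  ∃ λ (w : Fin n → ℚ) → ∃ λ (q : ℚ) →
      (∀ i → 0ℚ ≤ w i)
    × ¬ ((∀ i → w i ≡ 0ℚ) × q ≡ 0ℚ)
    × (∀ X → weight w X < q → Losing G X)
    × (∀ X → weight w X > q → Winning G X)

occ : {n k : ℕ} → Vec (Subset n) k → Fin n → ℕ
occ []       i = 0
occ (X ∷ Xs) i with i ∈? X
... | yes _ = suc (occ Xs i)
... | no  _ = occ Xs i

-- An EL sequence of degree k consists of 2k coalitions, k winning ones (Xs)
-- and k blocking ones (Ys).  Some player occurs in at least half (= k) of them.
AtLeastHalfFor : {n : ℕ} → SimpleGame n → (k : ℕ) → Set
AtLeastHalfFor {n} G k =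
  (Xs Ys : Vec (Subset n) k) → All (Winning G) Xs → All (Blocking G) Ys →
  ∃ λ (i : Fin n) → k ≤ℕ occ Xs i +ℕ occ Ys i

-- The at-least-half property of degree d: every EL sequence of degree k ≤ d.
-- The degree in the theorem is the real number (n+1)·2^{(n log₂ n)/2} = (n+1)·n^{n/2};
-- for a natural k, k ≤ (n+1)·n^{n/2}  ⇔  k·k ≤ (n+1)²·nⁿ.
WithinTheoremDegree : ℕ → ℕ → Set
WithinTheoremDegree n k = k * k ≤ℕ (suc n * suc n) * n ^ n

AtLeastHalfTheoremDegree : {n : ℕ} → SimpleGame n → Set
AtLeastHalfTheoremDegree {n} G = ∀ k → WithinTheoremDegree n k → AtLeastHalfFor G k

module Submission where

-- A rough weighting yields, summing weights over an EL sequence of degree k, a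
-- total of at least k times the weight of all players, which is impossible if
-- every player occurs fewer than k times.
--
-- Conversely, consider the differences X − L ∈ {−1,0,1}ⁿ of winning and losing
-- coalitions together with the unit vectors.  By Farkas' lemma either some w
-- has non-negative product with all of them and w ≠ 0 (a rough weighting), or
-- d·(−1,…,−1) with d > 0 is a non-negative integral combination of linearly
-- independent ones.  Using the pair (X, complement of L) as often as X − L
-- occurs in the combination gives an EL sequence without a player in half of
-- its coalitions.  By Cramer's rule the at most n coefficients can be taken to
-- be minors of vectors of squared length at most n, so they are at most n^(n/2)
-- by Hadamard's inequality |v ∧ ω| ≤ |v| |ω|.

open import Defs
open import Algebra.Bundles using (CommutativeMonoid)
open import Data.Bool using (true; false; not; if_then_else_; _≟_)
open import Data.Bool.Properties using (not-involutive)
open import Data.Fin using (Fin; zero; suc)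
open import Data.Fin.Properties using (any?)
open import Data.Fin.Subset using (Subset; ⁅_⁆; ⊤; ⊥; ∁; ∣_∣)
open import Data.Fin.Subset.Properties using (_∈?_; ∣p∣≤n; anySubset?)
open import Data.Integer using (ℤ; +_; -[1+_]; 0ℤ; 1ℤ; -1ℤ; _+_; _*_; _-_; -_; _≤_; _<_; +≤+; -<+; nonNegative)
import Data.Integer as ℤ
import Data.Integer.Properties as ℤ
open import Data.Integer.Tactic.RingSolver using (solve-∀)
open import Data.List using (List; []; _∷_; _++_; length; map; cartesianProduct; allFin)
open import Data.List.Extrema ℤ.≤-totalOrder using (argmin; f[argmin]≤f[xs])
open import Data.List.Membership.Propositional using (_∈_)
open import Data.List.Membership.Propositional.Properties using (∈-∃++; ∈-map⁺; ∈-++⁺ˡ; ∈-++⁺ʳ; ∈-cartesianProduct⁺; ∈-allFin)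
open import Data.List.Properties using (length-map)
open import Data.List.Relation.Unary.All as All using (All; []; _∷_)
import Data.List.Relation.Unary.All.Properties as All
open import Data.List.Relation.Unary.Any using (here; there)
open import Data.Nat using (ℕ; zero; suc; z≤n; s≤s; _^_)
import Data.Nat as ℕ
import Data.Nat.Coprimality as Coprimality
open import Data.Nat.ListAction using (sum)
import Data.Nat.Properties as ℕ
open import Data.Nat.Tactic.RingSolver renaming (solve-∀ to solveℕ-∀)
open import Data.Product using (∃; _×_; _,_; proj₁; proj₂)
open import Data.Rational using (ℚ; 0ℚ; mkℚ)
import Data.Rational as ℚ
import Data.Rational.Properties as ℚ
import Data.Rational.Unnormalised as ℚᵘ
import Data.Rational.Unnormalised.Properties as ℚᵘ
open import Data.Sum using (_⊎_; inj₁; inj₂)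
open import Data.Vec using (Vec; []; _∷_; lookup)
open import Data.Vec.Functional using (Vector; tail)
import Data.Vec.Properties as Vec
open import Data.Vec.Relation.Unary.All as Vec using ([]; _∷_)
open import Function using (_∘_)
open import Relation.Binary.PropositionalEquality
open import Relation.Nullary using (¬_; Dec; yes; no; ¬?; contradiction)
open import Relation.Nullary.Decidable using (decidable-stable)
open import Algebra.Definitions.RawMonoid ℚ.+-0-rawMonoid using () renaming (_×_ to _·_)
open import Algebra.Properties.CommutativeMonoid.Mult ℚ.+-0-commutativeMonoid using (×-homo-+; ×-distrib-+)
open import Algebra.Properties.CommutativeSemigroup (CommutativeMonoid.commutativeSemigroup ℚ.+-0-commutativeMonoid) using (interchange)

private variable
  n : ℕ
  I I′ : Set

-- The dot product on ℤⁿ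

dot : Vector ℤ n → Vector ℤ n → ℤ
dot {zero}  u v = 0ℤ
dot {suc n} u v = u zero * v zero + dot (tail u) (tail v)

dot-comm : ∀ (u v : Vector ℤ n) → dot u v ≡ dot v u
dot-comm {zero}  u v = refl
dot-comm {suc n} u v = cong₂ _+_ (ℤ.*-comm (u zero) (v zero)) (dot-comm (tail u) (tail v))

dot-congʳ : ∀ (w : Vector ℤ n) {u v : Vector ℤ n} → u ≗ v → dot w u ≡ dot w v
dot-congʳ {zero}  w u≗v = refl
dot-congʳ {suc n} w u≗v = cong₂ _+_ (cong (w zero *_) (u≗v zero)) (dot-congʳ (tail w) (u≗v ∘ suc))

zero-combination : ∀ c d → 0ℤ ≡ c * 0ℤ + d * 0ℤ
zero-combination = solve-∀

dot-linearʳ : ∀ (w : Vector ℤ n) c u d v →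
  dot w (λ k → c * u k + d * v k) ≡ c * dot w u + d * dot w v
dot-linearʳ {zero}  w c u d v = zero-combination c d
dot-linearʳ {suc n} w c u d v =
  trans (cong (λ p → w zero * (c * u zero + d * v zero) + p) (dot-linearʳ (tail w) c (tail u) d (tail v)))
        (step (w zero) c (u zero) d (v zero) (dot (tail w) (tail u)) (dot (tail w) (tail v)))
  where
  step : ∀ w c u d v p q → w * (c * u + d * v) + (c * p + d * q) ≡ c * (w * u + p) + d * (w * v + q)
  step = solve-∀

dot-linearˡ : ∀ c u d v (w : Vector ℤ n) →
  dot (λ k → c * u k + d * v k) w ≡ c * dot u w + d * dot v w
dot-linearˡ c u d v w = begin
  dot (λ k → c * u k + d * v k) w  ≡⟨ dot-comm _ w ⟩
  dot w (λ k → c * u k + d * v k)  ≡⟨ dot-linearʳ w c u d v ⟩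
  c * dot w u + d * dot w v        ≡⟨ cong₂ (λ p q → c * p + d * q) (dot-comm w u) (dot-comm w v) ⟩
  c * dot u w + d * dot v w        ∎
  where open ≡-Reasoning

i²≥0 : ∀ i → 0ℤ ≤ i * i
i²≥0 (+ zero)  = +≤+ z≤n
i²≥0 (+ suc n) = +≤+ z≤n
i²≥0 -[1+ n ]  = +≤+ z≤n

dot-nonneg : ∀ (v : Vector ℤ n) → 0ℤ ≤ dot v v
dot-nonneg {zero}  v = ℤ.≤-refl
dot-nonneg {suc n} v = ℤ.+-mono-≤ (i²≥0 (v zero)) (dot-nonneg (tail v))

-- The exterior algebra of ℤⁿ

-- ω S is the coefficient of the basis element e_S.  Splitting ω by its first
-- argument writes it as ω₀ + e₀ ∧ ω₁, with ω₀ and ω₁ free of e₀; the signs in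
-- wedge and contract come from moving a vector past e₀.
Form : ℕ → Set
Form n = Subset n → ℤ

wedge : Vector ℤ n → Form n → Form n
wedge v ω []          = 0ℤ
wedge v ω (false ∷ S) = wedge (tail v) (ω ∘ (false ∷_)) S
wedge v ω (true  ∷ S) = v zero * ω (false ∷ S) - wedge (tail v) (ω ∘ (true ∷_)) S

-- The interior product, with v acting as the linear form `dot v`.
contract : Vector ℤ n → Form n → Form n
contract v ω []          = 0ℤ
contract v ω (false ∷ S) = v zero * ω (true ∷ S) + contract (tail v) (ω ∘ (false ∷_)) S
contract v ω (true  ∷ S) = - contract (tail v) (ω ∘ (true ∷_)) S

wedge-cong : ∀ (v : Vector ℤ n) {α β : Form n} → α ≗ β → wedge v α ≗ wedge v β
wedge-cong v α≗β []          = refl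
wedge-cong v α≗β (false ∷ S) = wedge-cong (tail v) (α≗β ∘ (false ∷_)) S
wedge-cong v α≗β (true  ∷ S) =
  cong₂ (λ p q → v zero * p - q) (α≗β (false ∷ S)) (wedge-cong (tail v) (α≗β ∘ (true ∷_)) S)

contract-cong : ∀ (v : Vector ℤ n) {α β : Form n} → α ≗ β → contract v α ≗ contract v β
contract-cong v α≗β []          = refl
contract-cong v α≗β (false ∷ S) =
  cong₂ (λ p q → v zero * p + q) (α≗β (true ∷ S)) (contract-cong (tail v) (α≗β ∘ (false ∷_)) S)
contract-cong v α≗β (true  ∷ S) = cong -_ (contract-cong (tail v) (α≗β ∘ (true ∷_)) S)

wedge-linear : ∀ (v : Vector ℤ n) c (α : Form n) d β S →
  wedge v (λ T → c * α T + d * β T) S ≡ c * wedge v α S + d * wedge v β S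
wedge-linear v c α d β []          = zero-combination c d
wedge-linear v c α d β (false ∷ S) = wedge-linear (tail v) c (α ∘ (false ∷_)) d (β ∘ (false ∷_)) S
wedge-linear v c α d β (true  ∷ S) =
  trans (cong (λ p → v zero * (c * α (false ∷ S) + d * β (false ∷ S)) - p)
              (wedge-linear (tail v) c (α ∘ (true ∷_)) d (β ∘ (true ∷_)) S))
        (step (v zero) c (α (false ∷ S)) d (β (false ∷ S)) _ _)
  where
  step : ∀ x c a d b p q → x * (c * a + d * b) - (c * p + d * q) ≡ c * (x * a - p) + d * (x * b - q)
  step = solve-∀

wedge-linear-vector : ∀ c (u : Vector ℤ n) d v (ω : Form n) S →
  wedge (λ k → c * u k + d * v k) ω S ≡ c * wedge u ω S + d * wedge v ω S
wedge-linear-vector c u d v ω []          = zero-combination c d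
wedge-linear-vector c u d v ω (false ∷ S) =
  wedge-linear-vector c (tail u) d (tail v) (ω ∘ (false ∷_)) S
wedge-linear-vector c u d v ω (true  ∷ S) =
  trans (cong (λ p → (c * u zero + d * v zero) * ω (false ∷ S) - p)
              (wedge-linear-vector c (tail u) d (tail v) (ω ∘ (true ∷_)) S))
        (step c (u zero) d (v zero) (ω (false ∷ S)) _ _)
  where
  step : ∀ c x d y a p q → (c * x + d * y) * a - (c * p + d * q) ≡ c * (x * a - p) + d * (y * a - q)
  step = solve-∀

wedge-cong-vector : ∀ {n} {u v : Vector ℤ n} → u ≗ v → (ω : Form n) → wedge u ω ≗ wedge v ω
wedge-cong-vector u≗v ω []          = refl
wedge-cong-vector u≗v ω (false ∷ S) = wedge-cong-vector (u≗v ∘ suc) _ S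
wedge-cong-vector u≗v ω (true  ∷ S) =
  cong₂ (λ x p → x * ω (false ∷ S) - p) (u≗v zero) (wedge-cong-vector (u≗v ∘ suc) _ S)

contract-linear : ∀ (v : Vector ℤ n) c (α : Form n) d β S →
  contract v (λ T → c * α T + d * β T) S ≡ c * contract v α S + d * contract v β S
contract-linear v c α d β []          = zero-combination c d
contract-linear v c α d β (false ∷ S) =
  trans (cong (λ p → v zero * (c * α (true ∷ S) + d * β (true ∷ S)) + p)
              (contract-linear (tail v) c (α ∘ (false ∷_)) d (β ∘ (false ∷_)) S))
        (step (v zero) c (α (true ∷ S)) d (β (true ∷ S)) _ _)
  where
  step : ∀ x c a d b p q → x * (c * a + d * b) + (c * p + d * q) ≡ c * (x * a + p) + d * (x * b + q)
  step = solve-∀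
contract-linear v c α d β (true  ∷ S) =
  trans (cong -_ (contract-linear (tail v) c (α ∘ (true ∷_)) d (β ∘ (true ∷_)) S)) (step c d _ _)
  where
  step : ∀ c d p q → - (c * p + d * q) ≡ c * (- p) + d * (- q)
  step = solve-∀

-- The linearity lemmas speak of the shape `c * x + d * y` only; this identity and the next three
-- bring other expressions into it.
drop-zero-term : ∀ c x → c * x + 0ℤ * x ≡ c * x
drop-zero-term = solve-∀

expand-minus : ∀ c x y → c * x - y ≡ c * x + -1ℤ * y
expand-minus = solve-∀

expand-plus : ∀ c x y → c * x + y ≡ c * x + 1ℤ * y
expand-plus = solve-∀

expand-neg : ∀ x y → - x ≡ -1ℤ * x + 0ℤ * y
expand-neg = solve-∀

wedge-scale : ∀ (v : Vector ℤ n) c (α : Form n) S → wedge v (λ T → c * α T) S ≡ c * wedge v α S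
wedge-scale v c α S = begin
  wedge v (λ T → c * α T) S                ≡⟨ wedge-cong v (λ T → sym (drop-zero-term c (α T))) S ⟩
  wedge v (λ T → c * α T + 0ℤ * α T) S     ≡⟨ wedge-linear v c α 0ℤ α S ⟩
  c * wedge v α S + 0ℤ * wedge v α S       ≡⟨ drop-zero-term c _ ⟩
  c * wedge v α S                          ∎
  where open ≡-Reasoning

wedge-zero : ∀ (v : Vector ℤ n) {ω : Form n} → (∀ S → ω S ≡ 0ℤ) → ∀ S → wedge v ω S ≡ 0ℤ
-- `0ℤ * x` computes to `0ℤ`, so the zero form is a scaling by 0. Linearity with coefficients 0
-- serves likewise for `contract`, for zero vectors and for `dot`.
wedge-zero v {ω} ω≡0 S = trans (wedge-cong v ω≡0 S) (wedge-scale v 0ℤ ω S)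

contract-zero : ∀ (v : Vector ℤ n) {ω : Form n} → (∀ S → ω S ≡ 0ℤ) → ∀ S → contract v ω S ≡ 0ℤ
contract-zero v {ω} ω≡0 S =
  trans (contract-cong v ω≡0 S) (contract-linear v 0ℤ ω 0ℤ ω S)

-- In the coefficients without e₀ only the tails act. In those with e₀ the terms in `u zero` and
-- `v zero` cancel, which leaves the identity for the tails.
wedge-anticomm : ∀ (u v : Vector ℤ n) (ω : Form n) S →
  wedge u (wedge v ω) S + wedge v (wedge u ω) S ≡ 0ℤ
wedge-anticomm u v ω []          = refl
wedge-anticomm u v ω (false ∷ S) = wedge-anticomm (tail u) (tail v) (ω ∘ (false ∷_)) S
wedge-anticomm u v ω (true  ∷ S) = begin
  (u zero * b - wedge u' (λ T → v zero * ω₀ T - wedge v' ω₁ T) S) +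
  (v zero * a - wedge v' (λ T → u zero * ω₀ T - wedge u' ω₁ T) S)
    ≡⟨ cong₂ (λ p q → (u zero * b - p) + (v zero * a - q)) (expand u' v' (v zero)) (expand v' u' (u zero)) ⟩
  (u zero * b - (v zero * a + -1ℤ * wedge u' (wedge v' ω₁) S)) +
  (v zero * a - (u zero * b + -1ℤ * wedge v' (wedge u' ω₁) S))
    ≡⟨ step (u zero) b (v zero) a _ _ ⟩
  wedge u' (wedge v' ω₁) S + wedge v' (wedge u' ω₁) S
    ≡⟨ wedge-anticomm u' v' ω₁ S ⟩
  0ℤ ∎
  where
  open ≡-Reasoning
  u' = tail u
  v' = tail v
  ω₀ = ω ∘ (false ∷_)
  ω₁ = ω ∘ (true ∷_)
  a = wedge u' ω₀ S
  b = wedge v' ω₀ S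
  expand : ∀ f g y → wedge f (λ T → y * ω₀ T - wedge g ω₁ T) S ≡ y * wedge f ω₀ S + -1ℤ * wedge f (wedge g ω₁) S
  expand f g y = trans (wedge-cong f (λ T → expand-minus y (ω₀ T) (wedge g ω₁ T)) S) (wedge-linear f y ω₀ -1ℤ (wedge g ω₁) S)
  step : ∀ x b y a p q → (x * b - (y * a + -1ℤ * p)) + (y * a - (x * b + -1ℤ * q)) ≡ p + q
  step = solve-∀

i+i≡0⇒i≡0 : ∀ i → i + i ≡ 0ℤ → i ≡ 0ℤ
i+i≡0⇒i≡0 (+ zero) _ = refl

-- Anticommutativity gives that twice the coefficient is 0, and ℤ has no 2-torsion.
wedge-self : ∀ (v : Vector ℤ n) (ω : Form n) S → wedge v (wedge v ω) S ≡ 0ℤ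
wedge-self v ω S = i+i≡0⇒i≡0 _ (wedge-anticomm v v ω S)

-- The anticommutation relation of interior and exterior multiplication. In each coefficient the
-- mixed terms cancel, and the first coordinates add `f zero * v zero` to the relation for the
-- tails.
contract-wedge : ∀ (f v : Vector ℤ n) (ω : Form n) S →
  contract f (wedge v ω) S + wedge v (contract f ω) S ≡ dot f v * ω S
contract-wedge f v ω []          = refl
contract-wedge f v ω (false ∷ S) = begin
  (f zero * (v zero * ω₀ S - wedge v' ω₁ S) + contract f' (wedge v' ω₀) S) +
  wedge v' (λ T → f zero * ω₁ T + contract f' ω₀ T) S
    ≡⟨ cong (λ p → (f zero * (v zero * ω₀ S - wedge v' ω₁ S) + contract f' (wedge v' ω₀) S) + p)
         (trans (wedge-cong v' (λ T → expand-plus (f zero) (ω₁ T) (contract f' ω₀ T)) S)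
                (wedge-linear v' (f zero) ω₁ 1ℤ (contract f' ω₀) S)) ⟩
  (f zero * (v zero * ω₀ S - wedge v' ω₁ S) + contract f' (wedge v' ω₀) S) +
  (f zero * wedge v' ω₁ S + 1ℤ * wedge v' (contract f' ω₀) S)
    ≡⟨ step₁ (f zero) (v zero) (ω₀ S) _ _ _ ⟩
  f zero * v zero * ω₀ S + (contract f' (wedge v' ω₀) S + wedge v' (contract f' ω₀) S)
    ≡⟨ cong (λ p → f zero * v zero * ω₀ S + p) (contract-wedge f' v' ω₀ S) ⟩
  f zero * v zero * ω₀ S + dot f' v' * ω₀ S
    ≡⟨ sym (ℤ.*-distribʳ-+ (ω₀ S) (f zero * v zero) (dot f' v')) ⟩
  (f zero * v zero + dot f' v') * ω₀ S ∎
  where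
  open ≡-Reasoning
  f' = tail f
  v' = tail v
  ω₀ = ω ∘ (false ∷_)
  ω₁ = ω ∘ (true ∷_)
  step₁ : ∀ z x a p q r → (z * (x * a - p) + q) + (z * p + 1ℤ * r) ≡ z * x * a + (q + r)
  step₁ = solve-∀
contract-wedge f v ω (true ∷ S) = begin
  - contract f' (λ T → v zero * ω₀ T - wedge v' ω₁ T) S +
  (v zero * (f zero * ω₁ S + contract f' ω₀ S) - wedge v' (λ T → - contract f' ω₁ T) S)
    ≡⟨ cong₂ (λ p q → - p + (v zero * (f zero * ω₁ S + contract f' ω₀ S) - q))
         (trans (contract-cong f' (λ T → expand-minus (v zero) (ω₀ T) (wedge v' ω₁ T)) S)
                (contract-linear f' (v zero) ω₀ -1ℤ (wedge v' ω₁) S))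
         (trans (wedge-cong v' (λ T → sym (ℤ.-1*i≡-i (contract f' ω₁ T))) S)
                (wedge-scale v' -1ℤ (contract f' ω₁) S)) ⟩
  - (v zero * contract f' ω₀ S + -1ℤ * contract f' (wedge v' ω₁) S) +
  (v zero * (f zero * ω₁ S + contract f' ω₀ S) - -1ℤ * wedge v' (contract f' ω₁) S)
    ≡⟨ step₂ (f zero) (v zero) (ω₁ S) _ _ _ ⟩
  f zero * v zero * ω₁ S + (contract f' (wedge v' ω₁) S + wedge v' (contract f' ω₁) S)
    ≡⟨ cong (λ p → f zero * v zero * ω₁ S + p) (contract-wedge f' v' ω₁ S) ⟩
  f zero * v zero * ω₁ S + dot f' v' * ω₁ S
    ≡⟨ sym (ℤ.*-distribʳ-+ (ω₁ S) (f zero * v zero) (dot f' v')) ⟩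
  (f zero * v zero + dot f' v') * ω₁ S ∎
  where
  open ≡-Reasoning
  f' = tail f
  v' = tail v
  ω₀ = ω ∘ (false ∷_)
  ω₁ = ω ∘ (true ∷_)
  step₂ : ∀ z x a c p r → - (x * c + -1ℤ * p) + (x * (z * a + c) - -1ℤ * r) ≡ z * x * a + (p + r)
  step₂ = solve-∀

-- The inner product of forms with the e_S orthonormal, and Lagrange's identity

inner : Form n → Form n → ℤ
inner {zero}  α β = α [] * β []
inner {suc n} α β = inner (α ∘ (false ∷_)) (β ∘ (false ∷_)) + inner (α ∘ (true ∷_)) (β ∘ (true ∷_))

inner-comm : ∀ (α β : Form n) → inner α β ≡ inner β α
inner-comm {zero}  α β = ℤ.*-comm (α []) (β [])
inner-comm {suc n} α β = cong₂ _+_ (inner-comm {n} _ _) (inner-comm {n} _ _)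

inner-congʳ : ∀ (α : Form n) {β γ : Form n} → β ≗ γ → inner α β ≡ inner α γ
inner-congʳ {zero}  α β≗γ = cong (α [] *_) (β≗γ [])
inner-congʳ {suc n} α β≗γ = cong₂ _+_ (inner-congʳ _ (β≗γ ∘ (false ∷_))) (inner-congʳ _ (β≗γ ∘ (true ∷_)))

inner-linearʳ : ∀ (α : Form n) c β d γ →
  inner α (λ S → c * β S + d * γ S) ≡ c * inner α β + d * inner α γ
inner-linearʳ {zero}  α c β d γ = step (α []) c (β []) d (γ [])
  where
  step : ∀ a c b d g → a * (c * b + d * g) ≡ c * (a * b) + d * (a * g)
  step = solve-∀
inner-linearʳ {suc n} α c β d γ =
  trans (cong₂ _+_ (inner-linearʳ {n} _ c _ d _) (inner-linearʳ {n} _ c _ d _)) (step c _ d _ _ _)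
  where
  step : ∀ c p d q r s → (c * p + d * q) + (c * r + d * s) ≡ c * (p + r) + d * (q + s)
  step = solve-∀

inner-linearˡ : ∀ c (β : Form n) d γ α →
  inner (λ S → c * β S + d * γ S) α ≡ c * inner β α + d * inner γ α
inner-linearˡ c β d γ α = begin
  inner (λ S → c * β S + d * γ S) α    ≡⟨ inner-comm _ α ⟩
  inner α (λ S → c * β S + d * γ S)    ≡⟨ inner-linearʳ α c β d γ ⟩
  c * inner α β + d * inner α γ        ≡⟨ cong₂ (λ p q → c * p + d * q) (inner-comm α β) (inner-comm α γ) ⟩
  c * inner β α + d * inner γ α        ∎
  where open ≡-Reasoning

inner-congˡ : ∀ {n} {β γ : Form n} (α : Form n) → β ≗ γ → inner β α ≡ inner γ α
inner-congˡ {β = β} {γ} α β≗γ = trans (inner-comm β α) (trans (inner-congʳ α β≗γ) (inner-comm α γ))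

inner-nonneg : ∀ (α : Form n) → 0ℤ ≤ inner α α
inner-nonneg {zero}  α = i²≥0 (α [])
inner-nonneg {suc n} α = ℤ.+-mono-≤ (inner-nonneg {n} _) (inner-nonneg {n} _)

-- Bounds a single minor by the norm of a product of vectors: its square is one of the non-negative
-- summands of `inner α α`.
square≤inner : ∀ (α : Form n) S → α S * α S ≤ inner α α
square≤inner α []          = ℤ.≤-refl
square≤inner {suc n} α (false ∷ S) =
  subst (_≤ _) (ℤ.+-identityʳ _) (ℤ.+-mono-≤ (square≤inner (α ∘ (false ∷_)) S) (inner-nonneg {n} _))
square≤inner {suc n} α (true  ∷ S) =
  subst (_≤ _) (ℤ.+-identityˡ _) (ℤ.+-mono-≤ (inner-nonneg {n} _) (square≤inner (α ∘ (true ∷_)) S))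

-- Both sides expand into the same three inner products of the components of α and β without e₀.
adjoint : ∀ (v : Vector ℤ n) (α β : Form n) → inner α (wedge v β) ≡ inner (contract v α) β
adjoint {zero}  v α β = trans (ℤ.*-zeroʳ (α [])) (sym (ℤ.*-zeroˡ (β [])))
adjoint {suc n} v α β = begin
  inner α₀ (wedge v' β₀) + inner α₁ (λ S → x * β₀ S - wedge v' β₁ S)
    ≡⟨ cong₂ _+_ (adjoint v' α₀ β₀)
         (trans (inner-congʳ α₁ (λ S → expand-minus x (β₀ S) (wedge v' β₁ S))) (inner-linearʳ α₁ x β₀ -1ℤ (wedge v' β₁))) ⟩
  inner (contract v' α₀) β₀ + (x * inner α₁ β₀ + -1ℤ * inner α₁ (wedge v' β₁))
    ≡⟨ cong (λ p → inner (contract v' α₀) β₀ + (x * inner α₁ β₀ + -1ℤ * p)) (adjoint v' α₁ β₁) ⟩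
  inner (contract v' α₀) β₀ + (x * inner α₁ β₀ + -1ℤ * inner (contract v' α₁) β₁)
    -- The summand with coefficient 0 brings `- contract v' α₁` into the shape of `inner-linearˡ`.
    ≡⟨ step x _ _ _ (inner α₁ β₁) ⟩
  (x * inner α₁ β₀ + 1ℤ * inner (contract v' α₀) β₀) + (-1ℤ * inner (contract v' α₁) β₁ + 0ℤ * inner α₁ β₁)
    ≡⟨ sym (cong₂ _+_
         (trans (inner-congˡ β₀ (λ S → expand-plus x (α₁ S) (contract v' α₀ S))) (inner-linearˡ x α₁ 1ℤ (contract v' α₀) β₀))
         (trans (inner-congˡ β₁ (λ S → expand-neg (contract v' α₁ S) (α₁ S))) (inner-linearˡ -1ℤ (contract v' α₁) 0ℤ α₁ β₁))) ⟩
  inner (λ S → x * α₁ S + contract v' α₀ S) β₀ + inner (λ S → - contract v' α₁ S) β₁ ∎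
  where
  open ≡-Reasoning
  x = v zero
  v' = tail v
  α₀ = α ∘ (false ∷_)
  α₁ = α ∘ (true ∷_)
  β₀ = β ∘ (false ∷_)
  β₁ = β ∘ (true ∷_)
  step : ∀ x a b c e → a + (x * b + -1ℤ * c) ≡ (x * b + 1ℤ * a) + (-1ℤ * c + 0ℤ * e)
  step = solve-∀

-- wedge v and contract v are adjoint and their anticommutator is dot v v.
lagrange : ∀ (v : Vector ℤ n) (ω : Form n) →
  inner (wedge v ω) (wedge v ω) + inner (contract v ω) (contract v ω) ≡ dot v v * inner ω ω
lagrange v ω = begin
  inner (wedge v ω) (wedge v ω) + inner (contract v ω) (contract v ω)
    ≡⟨ cong₂ _+_ (adjoint v (wedge v ω) ω) (trans (sym (adjoint v ω (contract v ω))) (inner-comm ω _)) ⟩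
  inner (contract v (wedge v ω)) ω + inner (wedge v (contract v ω)) ω
    ≡⟨ step (inner (contract v (wedge v ω)) ω) (inner (wedge v (contract v ω)) ω) ⟩
  1ℤ * inner (contract v (wedge v ω)) ω + 1ℤ * inner (wedge v (contract v ω)) ω
    ≡⟨ sym (inner-linearˡ 1ℤ (contract v (wedge v ω)) 1ℤ (wedge v (contract v ω)) ω) ⟩
  inner (λ S → 1ℤ * contract v (wedge v ω) S + 1ℤ * wedge v (contract v ω) S) ω
    ≡⟨ inner-congˡ ω (λ S → trans (sym (step (contract v (wedge v ω) S) (wedge v (contract v ω) S)))
                               (trans (contract-wedge v v ω S) (sym (drop-zero-term (dot v v) (ω S))))) ⟩
  inner (λ S → dot v v * ω S + 0ℤ * ω S) ω
    ≡⟨ inner-linearˡ (dot v v) ω 0ℤ ω ω ⟩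
  dot v v * inner ω ω + 0ℤ * inner ω ω
    ≡⟨ drop-zero-term (dot v v) (inner ω ω) ⟩
  dot v v * inner ω ω ∎
  where
  open ≡-Reasoning
  step : ∀ a b → a + b ≡ 1ℤ * a + 1ℤ * b
  step = solve-∀

-- Lagrange's identity after dropping the non-negative norm of `contract v ω`.
inner-wedge-≤ : ∀ (v : Vector ℤ n) (ω : Form n) →
  inner (wedge v ω) (wedge v ω) ≤ dot v v * inner ω ω
inner-wedge-≤ v ω = subst₂ _≤_ (ℤ.+-identityʳ _) (lagrange v ω)
  (ℤ.+-monoʳ-≤ (inner (wedge v ω) (wedge v ω)) (inner-nonneg (contract v ω)))

-- Products of vectors: Hadamard's inequality, degree, repeated factors

one : Form n
one []          = 1ℤ
one (false ∷ S) = one S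
one (true  ∷ S) = 0ℤ

-- The coefficient at a set S of size `length is` is the minor with rows `a i` and columns S.
wedges : (I → Vector ℤ n) → List I → Form n
wedges a []       = one
wedges a (i ∷ is) = wedge (a i) (wedges a is)

inner-zeroˡ : (β : Form n) → inner (λ _ → 0ℤ) β ≡ 0ℤ
inner-zeroˡ {zero}  β = refl
inner-zeroˡ {suc n} β = cong₂ _+_ (inner-zeroˡ {n} _) (inner-zeroˡ {n} _)

inner-one : inner {n} one one ≡ 1ℤ
inner-one {zero}  = refl
inner-one {suc n} = cong₂ _+_ (inner-one {n}) (inner-zeroˡ {n} (λ _ → 0ℤ))

-- The unit has norm 1, and by `inner-wedge-≤` each factor multiplies the squared norm by at most B.
hadamard : (B : ℕ) (a : I → Vector ℤ n) → (∀ i → dot (a i) (a i) ≤ + B) → ∀ is →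
  inner (wedges a is) (wedges a is) ≤ + (B ^ length is)
hadamard {n = n} B a a≤B []   = ℤ.≤-reflexive (inner-one {n})
hadamard B a a≤B (i ∷ is) = begin
  inner (wedge (a i) ω) (wedge (a i) ω)  ≤⟨ inner-wedge-≤ (a i) ω ⟩
  dot (a i) (a i) * inner ω ω            ≤⟨ ℤ.*-monoʳ-≤-nonNeg (inner ω ω) {{nonNegative (inner-nonneg ω)}} (a≤B i) ⟩
  + B * inner ω ω                        ≤⟨ ℤ.*-monoˡ-≤-nonNeg (+ B) (hadamard B a a≤B is) ⟩
  + B * + (B ^ length is)                ≡⟨ sym (ℤ.pos-* B (B ^ length is)) ⟩
  + (B ^ length (i ∷ is))                ∎
  where
  open ℤ.≤-Reasoning
  ω = wedges a is

∣i∣²≡i² : ∀ i → + (ℤ.∣ i ∣ ℕ.* ℤ.∣ i ∣) ≡ i * i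
∣i∣²≡i² (+ zero)  = refl
∣i∣²≡i² (+ suc n) = refl
∣i∣²≡i² -[1+ n ]  = refl

VanishesBelow : ℕ → Form n → Set
VanishesBelow d ω = ∀ S → ∣ S ∣ ℕ.< d → ω S ≡ 0ℤ

wedge-vanishesBelow : ∀ d (v : Vector ℤ n) {ω} → VanishesBelow d ω → VanishesBelow (suc d) (wedge v ω)
wedge-vanishesBelow d v ω↓ []          _   = refl
wedge-vanishesBelow d v ω↓ (false ∷ S) S<d = wedge-vanishesBelow d (tail v) (ω↓ ∘ (false ∷_)) S S<d
wedge-vanishesBelow (suc d) v ω↓ (true ∷ S) (s≤s S<d)
  rewrite ω↓ (false ∷ S) S<d
        | wedge-vanishesBelow d (tail v) (λ T T<d → ω↓ (true ∷ T) (s≤s T<d)) S S<d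
        | ℤ.*-zeroʳ (v zero) = refl

wedges-vanishesBelow : (a : I → Vector ℤ n) → ∀ is → VanishesBelow (length is) (wedges a is)
wedges-vanishesBelow a []       S ()
wedges-vanishesBelow a (i ∷ is) = wedge-vanishesBelow (length is) (a i) (wedges-vanishesBelow a is)

-- A product of more than n factors vanishes at every S, because S has at most n elements.
nonzero⇒length≤n : (a : I → Vector ℤ n) → ∀ is S → wedges a is S ≢ 0ℤ → length is ℕ.≤ n
nonzero⇒length≤n a is S ω≢0 with length is ℕ.≤? _
... | yes le = le
... | no  gt = contradiction (wedges-vanishesBelow a is S (ℕ.≤-<-trans (∣p∣≤n S) (ℕ.≰⇒> gt))) ω≢0

wedge-swap : (u v : Vector ℤ n) (ω : Form n) → ∀ S → wedge u (wedge v ω) S ≡ - wedge v (wedge u ω) S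
wedge-swap u v ω S = trans (step _ _) (trans (cong (_- wedge v (wedge u ω) S) (wedge-anticomm u v ω S)) (ℤ.+-identityˡ _))
  where
  step : ∀ p q → p ≡ (p + q) - q
  step = solve-∀

-- `a i` is swapped past the other factors until it meets its copy, where `wedge-self` applies.
wedge-∈ : (a : I → Vector ℤ n) → ∀ {i is} → i ∈ is → ∀ S → wedge (a i) (wedges a is) S ≡ 0ℤ
wedge-∈ a {is = i ∷ is} (here refl) S = wedge-self (a i) (wedges a is) S
wedge-∈ a {i} {j ∷ is} (there i∈is) S = begin
  wedge (a i) (wedge (a j) (wedges a is)) S    ≡⟨ wedge-swap (a i) (a j) (wedges a is) S ⟩
  - wedge (a j) (wedge (a i) (wedges a is)) S  ≡⟨ cong -_ (wedge-zero (a j) (wedge-∈ a i∈is) S) ⟩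
  0ℤ                                           ∎
  where open ≡-Reasoning

-- Each swap on the way to the front changes the sign. Of σ only the absolute value is recorded,
-- since `cramer` compares absolute values.
wedges-insert : (a : I → Vector ℤ n) → ∀ is i js → ∃ λ σ → ℤ.∣ σ ∣ ≡ 1 ×
  (∀ S → wedges a (is ++ i ∷ js) S ≡ σ * wedge (a i) (wedges a (is ++ js)) S)
wedges-insert a []        i js = 1ℤ , refl , λ S → sym (ℤ.*-identityˡ _)
wedges-insert a (i′ ∷ is) i js with wedges-insert a is i js
... | σ , ∣σ∣≡1 , eq = - σ , trans (ℤ.∣-i∣≡∣i∣ σ) ∣σ∣≡1 , λ S → begin
  wedge (a i′) (wedges a (is ++ i ∷ js)) S                  ≡⟨ wedge-cong (a i′) eq S ⟩
  wedge (a i′) (λ T → σ * wedge (a i) (wedges a (is ++ js)) T) S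
                                                            ≡⟨ wedge-scale (a i′) σ _ S ⟩
  σ * wedge (a i′) (wedge (a i) (wedges a (is ++ js))) S    ≡⟨ cong (σ *_) (wedge-swap (a i′) (a i) _ S) ⟩
  σ * - wedge (a i) (wedge (a i′) (wedges a (is ++ js))) S  ≡⟨ step σ _ ⟩
  - σ * wedge (a i) (wedge (a i′) (wedges a (is ++ js))) S  ∎
  where
  open ≡-Reasoning
  step : ∀ s x → s * - x ≡ - s * x
  step = solve-∀

-- Farkas' lemma and Cramer's rule

-- Coefficients in ℕ build non-negativity into the type, so these are elements of the cone.
combination : (I → Vector ℤ n) → List (ℕ × I) → Vector ℤ n
combination a []             k = 0ℤ
combination a ((x , i) ∷ ps) k = + x * a i k + combination a ps k

combination-insert : (a : I → Vector ℤ n) → ∀ ps x i qs k →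
  combination a (ps ++ (x , i) ∷ qs) k ≡ + x * a i k + combination a (ps ++ qs) k
combination-insert a []             x i qs k = refl
combination-insert a ((y , j) ∷ ps) x i qs k =
  trans (cong (λ c → + y * a j k + c) (combination-insert a ps x i qs k))
        (step (+ y * a j k) (+ x * a i k) (combination a (ps ++ qs) k))
  where
  step : ∀ p q r → p + (q + r) ≡ q + (p + r)
  step = solve-∀

wedge-add : ∀ c (u v : Vector ℤ n) (ω : Form n) S →
  wedge (λ k → c * u k + v k) ω S ≡ c * wedge u ω S + wedge v ω S
wedge-add c u v ω S = begin
  wedge (λ k → c * u k + v k) ω S       ≡⟨ wedge-cong-vector (λ k → expand-plus c (u k) (v k)) ω S ⟩
  wedge (λ k → c * u k + 1ℤ * v k) ω S  ≡⟨ wedge-linear-vector c u 1ℤ v ω S ⟩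
  c * wedge u ω S + 1ℤ * wedge v ω S    ≡⟨ sym (expand-plus c (wedge u ω S) (wedge v ω S)) ⟩
  c * wedge u ω S + wedge v ω S         ∎
  where open ≡-Reasoning

wedge-zero-vector : (ω : Form n) → ∀ S → wedge (λ _ → 0ℤ) ω S ≡ 0ℤ
wedge-zero-vector ω S = wedge-linear-vector 0ℤ (λ _ → 0ℤ) 0ℤ (λ _ → 0ℤ) ω S

combination-wedge-zero : (a : I → Vector ℤ n) (ω : Form n) → ∀ S ps →
  All (λ p → wedge (a (proj₂ p)) ω S ≡ 0ℤ) ps → wedge (combination a ps) ω S ≡ 0ℤ
combination-wedge-zero a ω S []             []       = wedge-zero-vector ω S
combination-wedge-zero a ω S ((x , i) ∷ ps) (h ∷ hs) =
  trans (wedge-add (+ x) (a i) (combination a ps) ω S)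
        (cong₂ _+_ (trans (cong (+ x *_) h) (ℤ.*-zeroʳ (+ x))) (combination-wedge-zero a ω S ps hs))

-- Wedge the equation N b = ∑ xⱼ aⱼ with all the aⱼ but one: the other terms
-- die, because they repeat a factor.
cramer : (a : I → Vector ℤ n) (b : Vector ℤ n) → ∀ N ps x i qs →
  (∀ k → + N * b k ≡ combination a (ps ++ (x , i) ∷ qs) k) → ∀ S →
  N ℕ.* ℤ.∣ wedge b (wedges (a ∘ proj₂) (ps ++ qs)) S ∣
    ≡ x ℕ.* ℤ.∣ wedges (a ∘ proj₂) (ps ++ (x , i) ∷ qs) S ∣
cramer a b N ps x i qs eq S with wedges-insert (a ∘ proj₂) ps (x , i) qs
... | σ , ∣σ∣≡1 , insert = begin
  N ℕ.* ℤ.∣ wedge b ω S ∣                        ≡⟨ sym (ℤ.abs-* (+ N) (wedge b ω S)) ⟩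
  ℤ.∣ + N * wedge b ω S ∣                        ≡⟨ cong ℤ.∣_∣ expand ⟩
  ℤ.∣ + x * wedge (a i) ω S ∣                    ≡⟨ ℤ.abs-* (+ x) (wedge (a i) ω S) ⟩
  x ℕ.* ℤ.∣ wedge (a i) ω S ∣                    ≡⟨ cong (x ℕ.*_) (sym ∣insert∣) ⟩
  x ℕ.* ℤ.∣ wedges (a ∘ proj₂) (ps ++ (x , i) ∷ qs) S ∣ ∎
  where
  open ≡-Reasoning
  ω = wedges (a ∘ proj₂) (ps ++ qs)
  others : All (λ p → wedge (a (proj₂ p)) ω S ≡ 0ℤ) (ps ++ qs)
  others = All.tabulate (λ p∈ → wedge-∈ (a ∘ proj₂) p∈ S)
  scaled : ∀ c y → c * y ≡ c * y + 0ℤ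
  scaled = solve-∀
  expand : + N * wedge b ω S ≡ + x * wedge (a i) ω S
  expand = begin
    + N * wedge b ω S
      ≡⟨ trans (scaled (+ N) (wedge b ω S))
           (cong (λ z → + N * wedge b ω S + z) (sym (wedge-zero-vector ω S))) ⟩
    + N * wedge b ω S + wedge (λ _ → 0ℤ) ω S
      ≡⟨ sym (wedge-add (+ N) b (λ _ → 0ℤ) ω S) ⟩
    wedge (λ k → + N * b k + 0ℤ) ω S
      ≡⟨ wedge-cong-vector (λ k → trans (sym (scaled (+ N) (b k)))
                                  (trans (eq k) (combination-insert a ps x i qs k))) ω S ⟩
    wedge (λ k → + x * a i k + combination a (ps ++ qs) k) ω S
      ≡⟨ wedge-add (+ x) (a i) (combination a (ps ++ qs)) ω S ⟩
    + x * wedge (a i) ω S + wedge (combination a (ps ++ qs)) ω S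
      ≡⟨ cong (λ z → + x * wedge (a i) ω S + z) (combination-wedge-zero a ω S (ps ++ qs) others) ⟩
    + x * wedge (a i) ω S + 0ℤ
      ≡⟨ sym (scaled (+ x) _) ⟩
    + x * wedge (a i) ω S ∎
  ∣insert∣ : ℤ.∣ wedges (a ∘ proj₂) (ps ++ (x , i) ∷ qs) S ∣ ≡ ℤ.∣ wedge (a i) ω S ∣
  ∣insert∣ = begin
    ℤ.∣ wedges (a ∘ proj₂) (ps ++ (x , i) ∷ qs) S ∣  ≡⟨ cong ℤ.∣_∣ (insert S) ⟩
    ℤ.∣ σ * wedge (a i) ω S ∣                        ≡⟨ ℤ.abs-* σ _ ⟩
    ℤ.∣ σ ∣ ℕ.* ℤ.∣ wedge (a i) ω S ∣                ≡⟨ cong (ℕ._* ℤ.∣ wedge (a i) ω S ∣) ∣σ∣≡1 ⟩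
    1 ℕ.* ℤ.∣ wedge (a i) ω S ∣                      ≡⟨ ℕ.*-identityˡ _ ⟩
    ℤ.∣ wedge (a i) ω S ∣                            ∎

contract-one : (w : Vector ℤ n) → ∀ S → contract w one S ≡ 0ℤ
contract-one w []          = refl
contract-one w (false ∷ S) = cong₂ _+_ (ℤ.*-zeroʳ (w zero)) (contract-one (tail w) S)
contract-one w (true  ∷ S) = cong -_ (contract-zero (tail w) (λ _ → refl) S)

-- By `contract-wedge`, `contract w` anticommutes past every factor orthogonal to w until it reaches
-- `one`, which it kills.
contract-wedges : (w : Vector ℤ n) (a : I → Vector ℤ n) → (∀ i → dot w (a i) ≡ 0ℤ) →
  ∀ is S → contract w (wedges a is) S ≡ 0ℤ
contract-wedges w a w⊥a []       S = contract-one w S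
contract-wedges w a w⊥a (i ∷ is) S = begin
  contract w (wedge (a i) ω) S                                ≡⟨ step _ _ ⟩
  (contract w (wedge (a i) ω) S + wedge (a i) (contract w ω) S) - wedge (a i) (contract w ω) S
    ≡⟨ cong₂ _-_ (contract-wedge w (a i) ω S) (wedge-zero (a i) (contract-wedges w a w⊥a is) S) ⟩
  dot w (a i) * ω S - 0ℤ                                      ≡⟨ cong (λ d → d * ω S - 0ℤ) (w⊥a i) ⟩
  0ℤ * ω S - 0ℤ                                               ≡⟨⟩
  0ℤ                                                          ∎
  where
  open ≡-Reasoning
  ω = wedges a is
  step : ∀ p q → p ≡ (p + q) - q
  step = solve-∀

-- Adding multiples of u to the other factors is invisible after wedging with u.
wedge-shear : (u : Vector ℤ n) (a : I → Vector ℤ n) (c : ℤ) (e : I → ℤ) → ∀ is → ∃ λ s → ∀ S →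
  wedge u (wedges (λ i k → c * a i k + e i * u k) is) S ≡ s * wedge u (wedges a is) S
wedge-shear u a c e []       = 1ℤ , λ S → sym (ℤ.*-identityˡ _)
wedge-shear {I = I} u a c e (i ∷ is) with wedge-shear u a c e is
... | s , eq = c * s , λ S → begin
  wedge u (wedge (a′ i) ω′) S                                       ≡⟨ wedge-swap u (a′ i) ω′ S ⟩
  - wedge (a′ i) (wedge u ω′) S
    ≡⟨ cong -_ (wedge-linear-vector c (a i) (e i) u (wedge u ω′) S) ⟩
  - (c * wedge (a i) (wedge u ω′) S + e i * wedge u (wedge u ω′) S)
    ≡⟨ cong₂ (λ p q → - (c * p + e i * q))
         (trans (wedge-cong (a i) eq S) (wedge-scale (a i) s _ S)) (wedge-self u ω′ S) ⟩
  - (c * (s * wedge (a i) (wedge u ω) S) + e i * 0ℤ)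
    ≡⟨ cong (λ p → - (c * (s * p) + e i * 0ℤ)) (wedge-swap (a i) u ω S) ⟩
  - (c * (s * - wedge u (wedge (a i) ω) S) + e i * 0ℤ)              ≡⟨ step c s _ (e i) ⟩
  c * s * wedge u (wedge (a i) ω) S                                 ∎
  where
  open ≡-Reasoning
  a′ : I → Vector ℤ _
  a′ i k = c * a i k + e i * u k
  ω′ = wedges a′ is
  ω  = wedges a is
  step : ∀ c s x e → - (c * (s * - x) + e * 0ℤ) ≡ c * s * x
  step = solve-∀

wedges-map : (a : I′ → Vector ℤ n) (f : I → I′) → ∀ is → wedges a (map f is) ≗ wedges (a ∘ f) is
wedges-map a f []       S = refl
wedges-map a f (i ∷ is) S = wedge-cong (a (f i)) (wedges-map a f is) S

dot-combination : (w : Vector ℤ n) (a : I → Vector ℤ n) → ∀ x i ps →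
  dot w (combination a ((x , i) ∷ ps)) ≡ + x * dot w (a i) + dot w (combination a ps)
dot-combination w a x i ps =
  trans (dot-congʳ w (λ k → expand-plus (+ x) (a i k) (combination a ps k)))
 (trans (dot-linearʳ w (+ x) (a i) 1ℤ (combination a ps)) (sym (expand-plus (+ x) _ _)))

dot-zeroʳ : (w : Vector ℤ n) → dot w (λ _ → 0ℤ) ≡ 0ℤ
dot-zeroʳ w = dot-linearʳ w 0ℤ w 0ℤ w

dot-combination-nonneg : (w : Vector ℤ n) (a : I → Vector ℤ n) → ∀ ps →
  All (λ p → 0ℤ ≤ dot w (a (proj₂ p))) ps → 0ℤ ≤ dot w (combination a ps)
dot-combination-nonneg w a []             []       = ℤ.≤-reflexive (sym (dot-zeroʳ w))
dot-combination-nonneg w a ((x , i) ∷ ps) (h ∷ hs) =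
  subst (0ℤ ≤_) (sym (dot-combination w a x i ps))
    (ℤ.+-mono-≤ (subst (_≤ + x * dot w (a i)) (ℤ.*-zeroʳ (+ x)) (ℤ.*-monoˡ-≤-nonNeg (+ x) h))
                (dot-combination-nonneg w a ps hs))

-- The map v ↦ c v + (w·v) u is linear. With u = `a j` and c = -(w·u) it is the projection used in
-- `farkas`.
combination-shear : (w u : Vector ℤ n) (a : I → Vector ℤ n) (c : ℤ) → ∀ ps k →
  combination (λ i k → c * a i k + dot w (a i) * u k) ps k
    ≡ c * combination a ps k + dot w (combination a ps) * u k
combination-shear w u a c [] k rewrite dot-zeroʳ w = step c (u k)
  where
  step : ∀ c u → 0ℤ ≡ c * 0ℤ + 0ℤ * u
  step = solve-∀
combination-shear w u a c ((x , i) ∷ ps) k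
  rewrite combination-shear w u a c ps k | dot-combination w a x i ps =
    step (+ x) c (a i k) (dot w (a i)) (u k) (combination a ps k) (dot w (combination a ps))
  where
  step : ∀ x c a d u p q → x * (c * a + d * u) + (c * p + q * u) ≡ c * (x * a + p) + (x * d + q) * u
  step = solve-∀

scaleCoefficient : ℕ → ℕ × I → ℕ × I
scaleCoefficient m (x , i) = m ℕ.* x , i

combination-scale : (a : I → Vector ℤ n) → ∀ m ps k →
  combination a (map (scaleCoefficient m) ps) k ≡ + m * combination a ps k
combination-scale a m []             k = sym (ℤ.*-zeroʳ (+ m))
combination-scale a m ((x , i) ∷ ps) k =
    trans (cong₂ (λ p q → p * a i k + q) (ℤ.pos-* m x) (combination-scale a m ps k))
          (step (+ m) (+ x) (a i k) (combination a ps k))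
  where
  step : ∀ m x a p → m * x * a + m * p ≡ m * (x * a + p)
  step = solve-∀

dot≡0⇒≡0 : (v : Vector ℤ n) → dot v v ≡ 0ℤ → ∀ k → v k ≡ 0ℤ
dot≡0⇒≡0 v v·v≡0 zero    = square≡0 (v zero) (ℤ.≤-antisym
    (subst₂ _≤_ (ℤ.+-identityʳ _) v·v≡0 (ℤ.+-monoʳ-≤ (v zero * v zero) (dot-nonneg (tail v)))) (i²≥0 (v zero)))
  where
  square≡0 : ∀ i → i * i ≡ 0ℤ → i ≡ 0ℤ
  square≡0 (+ zero) _ = refl
dot≡0⇒≡0 v v·v≡0 (suc k) = dot≡0⇒≡0 (tail v) (ℤ.≤-antisym
    (subst₂ _≤_ (ℤ.+-identityˡ _) v·v≡0 (ℤ.+-monoˡ-≤ (dot (tail v) (tail v)) (i²≥0 (v zero)))) (dot-nonneg (tail v))) k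

Separated : (I → Vector ℤ n) → List I → Vector ℤ n → Set
Separated a is b = ∃ λ w → All (λ i → 0ℤ ≤ dot w (a i)) is × dot w b < 0ℤ

-- Rational cone membership with denominators cleared; the successor keeps the multiple of b
-- positive. A non-zero exterior product expresses linear independence of the terms.
record InCone (a : I → Vector ℤ n) (is : List I) (b : Vector ℤ n) : Set where
  constructor inCone
  field
    multiple-1  : ℕ
    terms       : List (ℕ × I)
    support     : All (λ p → proj₂ p ∈ is) terms
    equation    : ∀ k → + suc multiple-1 * b k ≡ combination a terms k
    independent : ¬ (∀ S → wedges (a ∘ proj₂) terms S ≡ 0ℤ)

one≢0 : ¬ (∀ S → one {n} S ≡ 0ℤ)
one≢0 {zero}  h with () ← h []
one≢0 {suc n} h = one≢0 {n} (h ∘ (false ∷_))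

-- Bartl's induction on the number of generators.  If w separates b from the
-- cone of all generators but aⱼ, and w·aⱼ < 0, project along aⱼ onto the
-- hyperplane w⊥, with the denominator -(w·aⱼ) cleared.  The projected support
-- lies in w⊥ and aⱼ does not, so independence is preserved.
farkas : (a : I → Vector ℤ n) → ∀ is b → Separated a is b ⊎ InCone a is b
farkas a [] b with dot b b in eq
... | + zero   = inj₂ (inCone 0 [] [] (λ k → trans (ℤ.*-identityˡ (b k)) (dot≡0⇒≡0 b eq k)) one≢0)
-- The cone without generators is zero, and -b separates any b ≠ 0 from it.
... | + suc m  = inj₁ ((λ k → -1ℤ * b k + 0ℤ * b k) , [] ,
                   subst (_< 0ℤ) (sym (trans (dot-linearˡ -1ℤ b 0ℤ b b) (cong (λ d → -1ℤ * d + 0ℤ * d) eq))) -<+)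
... | -[1+ m ] with () ← subst (0ℤ ≤_) eq (dot-nonneg b)
farkas {I} {n} a (j ∷ is) b with farkas a is b
... | inj₂ (inCone N ps ps⊆is eq ind) = inj₂ (inCone N ps (All.map there ps⊆is) eq ind)
... | inj₁ (w , w≥0 , w·b<0) with dot w (a j) in w·aj
...   | + m      = inj₁ (w , subst (0ℤ ≤_) (sym w·aj) (+≤+ z≤n) ∷ w≥0 , w·b<0)
...   | -[1+ m ] with farkas (λ i k → + suc m * a i k + dot w (a i) * a j k) is
                             (λ k → + suc m * b k + dot w b * a j k)
...     | inj₁ (w′ , w′≥0 , w′·b<0) =
  inj₁ (w″ , ℤ.≤-reflexive (sym w″⊥aj) ∷ All.map (λ {i} → subst (0ℤ ≤_) (sym (transport (a i)))) w′≥0 ,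
        subst (_< 0ℤ) (sym (transport b)) w′·b<0)
  where
  open ≡-Reasoning
  -- The transpose of the projection applied to w′: its product with v is that of w′ with the
  -- projected v, and it is orthogonal to `a j`, which the projection kills.
  w″ : Vector ℤ n
  w″ k = + suc m * w′ k + dot w′ (a j) * w k
  step : ∀ c p q r → c * p + q * r ≡ c * p + r * q
  step = solve-∀
  transport : ∀ v → dot w″ v ≡ dot w′ (λ k → + suc m * v k + dot w v * a j k)
  transport v = begin
    dot w″ v                                        ≡⟨ dot-linearˡ (+ suc m) w′ (dot w′ (a j)) w v ⟩
    + suc m * dot w′ v + dot w′ (a j) * dot w v     ≡⟨ step (+ suc m) (dot w′ v) (dot w′ (a j)) (dot w v) ⟩
    + suc m * dot w′ v + dot w v * dot w′ (a j)     ≡⟨ sym (dot-linearʳ w′ (+ suc m) v (dot w v) (a j)) ⟩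
    dot w′ (λ k → + suc m * v k + dot w v * a j k)  ∎
  cancel : ∀ c x → c * x + x * - c ≡ 0ℤ
  cancel = solve-∀
  w″⊥aj : dot w″ (a j) ≡ 0ℤ
  w″⊥aj = begin
    dot w″ (a j)                                          ≡⟨ dot-linearˡ (+ suc m) w′ (dot w′ (a j)) w (a j) ⟩
    + suc m * dot w′ (a j) + dot w′ (a j) * dot w (a j)   ≡⟨ cong (λ d → + suc m * dot w′ (a j) + dot w′ (a j) * d) w·aj ⟩
    + suc m * dot w′ (a j) + dot w′ (a j) * - (+ suc m)   ≡⟨ cancel (+ suc m) (dot w′ (a j)) ⟩
    0ℤ                                                    ∎
...     | inj₂ (inCone N ps ps⊆is eq ind) =
  -- Clearing the denominator of the projection multiplies the old multiple: `suc (m + N * suc m)`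
  -- computes to `suc N * suc m`.
  inj₂ (inCone (m ℕ.+ N ℕ.* suc m) ((ℤ.∣ y ∣ , j) ∷ map (scaleCoefficient (suc m)) ps)
    (here refl ∷ All.map⁺ (All.map there ps⊆is)) eq′ ind′)
  where
  open ≡-Reasoning
  a′ : I → Vector ℤ n
  a′ i k = + suc m * a i k + dot w (a i) * a j k
  s = dot w (combination a ps)
  -- The coefficient of `a j` once the projected equation is solved for b: s comes from projecting
  -- the terms, the rest from projecting b. Both parts are non-negative, since w is non-negative on
  -- the support and negative on b.
  y = s + + suc N * - dot w b
  y≥0 : 0ℤ ≤ y
  y≥0 = ℤ.+-mono-≤ (dot-combination-nonneg w a ps (All.map (λ p∈ → All.lookup w≥0 p∈) ps⊆is))
          (subst (_≤ + suc N * - dot w b) (ℤ.*-zeroʳ (+ suc N))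
            (ℤ.*-monoˡ-≤-nonNeg (+ suc N) (ℤ.neg-mono-≤ (ℤ.<⇒≤ w·b<0))))
  isolate : ∀ N c b d u → N * c * b ≡ N * (c * b + d * u) + - (N * (d * u))
  isolate = solve-∀
  collect : ∀ N c p s d u → (c * p + s * u) + - (N * (d * u)) ≡ (s + N * - d) * u + c * p
  collect = solve-∀
  eq′ : ∀ k → + (suc N ℕ.* suc m) * b k
            ≡ combination a ((ℤ.∣ y ∣ , j) ∷ map (scaleCoefficient (suc m)) ps) k
  eq′ k = begin
    + (suc N ℕ.* suc m) * b k
      ≡⟨ cong (_* b k) (ℤ.pos-* (suc N) (suc m)) ⟩
    + suc N * + suc m * b k
      ≡⟨ isolate (+ suc N) (+ suc m) (b k) (dot w b) (a j k) ⟩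
    + suc N * (+ suc m * b k + dot w b * a j k) + - (+ suc N * (dot w b * a j k))
      ≡⟨ cong (_+ - (+ suc N * (dot w b * a j k))) (trans (eq k) (combination-shear w (a j) a (+ suc m) ps k)) ⟩
    + suc m * combination a ps k + s * a j k + - (+ suc N * (dot w b * a j k))
      ≡⟨ collect (+ suc N) (+ suc m) (combination a ps k) s (dot w b) (a j k) ⟩
    y * a j k + + suc m * combination a ps k
      ≡⟨ cong₂ (λ y c → y * a j k + c) (sym (ℤ.0≤i⇒+∣i∣≡i y≥0)) (sym (combination-scale a (suc m) ps k)) ⟩
    combination a ((ℤ.∣ y ∣ , j) ∷ map (scaleCoefficient (suc m)) ps) k ∎
  cancel : ∀ c x → c * x + x * - c ≡ 0ℤ
  cancel = solve-∀
  w⊥a′ : ∀ i → dot w (a′ i) ≡ 0ℤ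
  w⊥a′ i = begin
    dot w (a′ i)                                                ≡⟨ dot-linearʳ w (+ suc m) (a i) (dot w (a i)) (a j) ⟩
    + suc m * dot w (a i) + dot w (a i) * dot w (a j)           ≡⟨ cong (λ d → + suc m * dot w (a i) + dot w (a i) * d) w·aj ⟩
    + suc m * dot w (a i) + dot w (a i) * - (+ suc m)           ≡⟨ cancel (+ suc m) (dot w (a i)) ⟩
    0ℤ                                                          ∎
  ω′ = wedges (a′ ∘ proj₂) ps
  ind′ : ¬ (∀ S → wedges (a ∘ proj₂) ((ℤ.∣ y ∣ , j) ∷ map (scaleCoefficient (suc m)) ps) S ≡ 0ℤ)
  -- `contract w` kills ω′, so `contract-wedge` turns the vanishing of `a j` ∧ ω′ into (w·`a j`) ω′
  -- = 0, and w·`a j` ≠ 0.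
  ind′ h = ind λ S → ℤ.*-cancelˡ-≡ (-[1+ m ]) (ω′ S) 0ℤ (begin
      -[1+ m ] * ω′ S                              ≡⟨ cong (_* ω′ S) (sym w·aj) ⟩
      dot w (a j) * ω′ S                           ≡⟨ sym (contract-wedge w (a j) ω′ S) ⟩
      contract w (wedge (a j) ω′) S + wedge (a j) (contract w ω′) S
        ≡⟨ cong₂ _+_ (contract-zero w aj∧ω′≡0 S)
                     (wedge-zero (a j) (contract-wedges w (a′ ∘ proj₂) (w⊥a′ ∘ proj₂) ps) S) ⟩
      0ℤ                                           ≡⟨ sym (ℤ.*-zeroʳ -[1+ m ]) ⟩
      -[1+ m ] * 0ℤ                                ∎)
    where
    aj∧ω′≡0 : ∀ S → wedge (a j) ω′ S ≡ 0ℤ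
    aj∧ω′≡0 S with wedge-shear (a j) (a ∘ proj₂) (+ suc m) (dot w ∘ a ∘ proj₂) ps
    ... | t , shear = begin
      wedge (a j) ω′ S                                ≡⟨ shear S ⟩
      t * wedge (a j) (wedges (a ∘ proj₂) ps) S
        ≡⟨ cong (t *_) (trans (sym (wedge-cong (a j) (wedges-map (a ∘ proj₂) (scaleCoefficient (suc m)) ps) S)) (h S)) ⟩
      t * 0ℤ                                          ≡⟨ ℤ.*-zeroʳ t ⟩
      0ℤ                                              ∎

-- Cone combinations with small coefficients

record SmallConeCombination (a : I → Vector ℤ n) (b : Vector ℤ n) (B : ℕ) : Set where
  field
    multiple-1  : ℕ
    terms       : List (ℕ × I)
    equation    : ∀ k → + suc multiple-1 * b k ≡ combination a terms k
    short       : length terms ℕ.≤ n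
    -- The bound B^(n/2) is stated through squares, which keeps it in ℕ.
    small       : All (λ p → proj₁ p ℕ.* proj₁ p ℕ.≤ B ^ n) terms

-- Cramer's rule relates every coefficient x to a minor y by `N * y ≡ x * d` with one common minor
-- d. Replacing each x by its y scales the combination by d/N.
rescale : (a : I → Vector ℤ n) → ∀ N d C ps →
  All (λ p → ∃ λ y → N ℕ.* y ≡ proj₁ p ℕ.* d × y ℕ.* y ℕ.≤ C) ps →
  ∃ λ qs → length qs ≡ length ps × All (λ q → proj₁ q ℕ.* proj₁ q ℕ.≤ C) qs ×
           (∀ k → + N * combination a qs k ≡ + d * combination a ps k)
rescale a N d C []             []                       = [] , refl , [] , λ k → trans (ℤ.*-zeroʳ (+ N)) (sym (ℤ.*-zeroʳ (+ d)))
rescale a N d C ((x , i) ∷ ps) ((y , Ny≡xd , y²≤C) ∷ hs) with rescale a N d C ps hs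
... | qs , len , small , eq = (y , i) ∷ qs , cong suc len , y²≤C ∷ small , λ k → begin
  + N * (+ y * a i k + combination a qs k)          ≡⟨ step₁ (+ N) (+ y) (a i k) (combination a qs k) ⟩
  + N * + y * a i k + + N * combination a qs k      ≡⟨ cong₂ (λ p q → p * a i k + q) Ny≡xd′ (eq k) ⟩
  + x * + d * a i k + + d * combination a ps k      ≡⟨ step₂ (+ x) (+ d) (a i k) (combination a ps k) ⟩
  + d * (+ x * a i k + combination a ps k)          ∎
  where
  open ≡-Reasoning
  Ny≡xd′ : + N * + y ≡ + x * + d
  Ny≡xd′ = trans (sym (ℤ.pos-* N y)) (trans (cong +_ Ny≡xd) (ℤ.pos-* x d))
  step₁ : ∀ N y a c → N * (y * a + c) ≡ N * y * a + N * c
  step₁ = solve-∀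
  step₂ : ∀ x d a c → x * d * a + d * c ≡ d * (x * a + c)
  step₂ = solve-∀

-- A non-zero minor of the independent terms becomes the new multiple of b. The new coefficients are
-- then minors with one term replaced by b, to which Hadamard's inequality applies.
smallConeCombination : (a : I → Vector ℤ n) → ∀ is b B .{{_ : ℕ.NonZero B}} →
  (∀ i → dot (a i) (a i) ≤ + B) → dot b b ≤ + B →
  InCone a is b → SmallConeCombination a b B
smallConeCombination {I} {n} a is b B a≤B b≤B (inCone N ps _ eq ind)
  -- Independence is a negation; searching the finitely many coefficients extracts a non-zero one.
  with anySubset? (λ S → ¬? (wedges (a ∘ proj₂) ps S ℤ.≟ 0ℤ))
... | no ∄S = contradiction (λ S → decidable-stable (_ ℤ.≟ _) (λ ω≢0 → ∄S (S , ω≢0))) ind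
... | yes (S , ω≢0) with ℤ.∣ wedges (a ∘ proj₂) ps S ∣ in ∣ω∣
...   | zero  = contradiction (ℤ.∣i∣≡0⇒i≡0 ∣ω∣) ω≢0
...   | suc d with rescale a (suc N) (suc d) (B ^ n) ps (All.tabulate coefficient)
  where
  short : length ps ℕ.≤ n
  short = nonzero⇒length≤n (a ∘ proj₂) ps S ω≢0
  coefficient : ∀ {p} → p ∈ ps → ∃ λ y → suc N ℕ.* y ≡ proj₁ p ℕ.* suc d × y ℕ.* y ℕ.≤ B ^ n
  coefficient {x , i} p∈ps with front , back , refl ← ∈-∃++ p∈ps =
    ℤ.∣ z ∣ , trans (cramer a b (suc N) front x i back eq S) (cong (x ℕ.*_) ∣ω∣) ,
    ℕ.≤-trans (ℤ.drop‿+≤+ (begin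
      + (ℤ.∣ z ∣ ℕ.* ℤ.∣ z ∣)            ≡⟨ ∣i∣²≡i² z ⟩
      z * z                              ≤⟨ square≤inner (wedge b ω) S ⟩
      inner (wedge b ω) (wedge b ω)      ≤⟨ inner-wedge-≤ b ω ⟩
      dot b b * inner ω ω                ≤⟨ ℤ.*-monoʳ-≤-nonNeg (inner ω ω) {{nonNegative (inner-nonneg ω)}} b≤B ⟩
      + B * inner ω ω                    ≤⟨ ℤ.*-monoˡ-≤-nonNeg (+ B) (hadamard B (a ∘ proj₂) (a≤B ∘ proj₂) (front ++ back)) ⟩
      + B * + (B ^ length (front ++ back)) ≡⟨ sym (ℤ.pos-* B _) ⟩
      + (B ^ suc (length (front ++ back))) ∎))
    -- b takes the place of the removed term, so the exponent is the length of `ps`, at most n.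
    -- Monotonicity of the power uses B ≠ 0.
    (ℕ.^-monoʳ-≤ B (subst (ℕ._≤ n) (length-++-∷ front) short))
    where
    open ℤ.≤-Reasoning
    ω = wedges (a ∘ proj₂) (front ++ back)
    z = wedge b ω S
    length-++-∷ : ∀ {A : Set} (xs : List A) {y ys} → length (xs ++ y ∷ ys) ≡ suc (length (xs ++ ys))
    length-++-∷ []       = refl
    length-++-∷ (x ∷ xs) = cong suc (length-++-∷ xs)
...     | qs , len , small , scaled = record
  { multiple-1 = d
  ; terms      = qs
  ; equation   = λ k → ℤ.*-cancelˡ-≡ (+ suc N) _ _ (begin
      + suc N * (+ suc d * b k)          ≡⟨ swap (+ suc N) (+ suc d) (b k) ⟩
      + suc d * (+ suc N * b k)          ≡⟨ cong (+ suc d *_) (eq k) ⟩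
      + suc d * combination a ps k       ≡⟨ sym (scaled k) ⟩
      + suc N * combination a qs k       ∎)
  ; short      = subst (ℕ._≤ n) (sym len) (nonzero⇒length≤n (a ∘ proj₂) ps S ω≢0)
  ; small      = small
  }
  where
  open ≡-Reasoning
  swap : ∀ p q r → p * (q * r) ≡ q * (p * r)
  swap = solve-∀

-- Simple games

member : Subset n → Fin n → ℕ
member X i = if lookup X i then 1 else 0

occ-∷ : ∀ {k} (X : Subset n) (Xs : Vec (Subset n) k) i → occ (X ∷ Xs) i ≡ member X i ℕ.+ occ Xs i
occ-∷ X Xs i with i ∈? X
... | yes i∈X rewrite Vec.[]=⇒lookup i∈X = refl
... | no  i∉X with lookup X i in eq
...   | true  = contradiction (Vec.lookup⇒[]= i X eq) i∉X
...   | false = refl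

-- The weight of a multiset of players. At `occ Xs` it counts the total weight of the coalitions in
-- Xs player by player.
load : Vector ℚ n → (Fin n → ℕ) → ℚ
load {zero}  w c = 0ℚ
load {suc n} w c = c zero · w zero ℚ.+ load (tail w) (tail c)

load-cong : (w : Vector ℚ n) {c d : Fin n → ℕ} → c ≗ d → load w c ≡ load w d
load-cong {zero}  w c≗d = refl
load-cong {suc n} w c≗d = cong₂ ℚ._+_ (cong (_· w zero) (c≗d zero)) (load-cong (tail w) (c≗d ∘ suc))

load-+ : (w : Vector ℚ n) (c d : Fin n → ℕ) → load w (λ i → c i ℕ.+ d i) ≡ load w c ℚ.+ load w d
load-+ {zero}  w c d = refl
load-+ {suc n} w c d = trans
  (cong₂ ℚ._+_ (×-homo-+ (w zero) (c zero) (d zero)) (load-+ (tail w) (tail c) (tail d)))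
  (interchange (c zero · w zero) (d zero · w zero) (load (tail w) (tail c)) (load (tail w) (tail d)))

·-nonneg : ∀ k {x} → 0ℚ ℚ.≤ x → 0ℚ ℚ.≤ k · x
·-nonneg zero    0≤x = ℚ.≤-refl
·-nonneg (suc k) 0≤x = ℚ.+-mono-≤ 0≤x (·-nonneg k 0≤x)

·-monoˡ-≤ : ∀ {k l x} → 0ℚ ℚ.≤ x → k ℕ.≤ l → k · x ℚ.≤ l · x
·-monoˡ-≤ {l = l} 0≤x z≤n     = ·-nonneg l 0≤x
·-monoˡ-≤ {x = x} 0≤x (s≤s p) = ℚ.+-monoʳ-≤ x (·-monoˡ-≤ 0≤x p)

load-mono-≤ : {w : Vector ℚ n} → (∀ i → 0ℚ ℚ.≤ w i) → {c d : Fin n → ℕ} → (∀ i → c i ℕ.≤ d i) → load w c ℚ.≤ load w d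
load-mono-≤ {zero}  w≥0 c≤d = ℚ.≤-refl
load-mono-≤ {suc n} w≥0 c≤d = ℚ.+-mono-≤ (·-monoˡ-≤ (w≥0 zero) (c≤d zero)) (load-mono-≤ (w≥0 ∘ suc) (c≤d ∘ suc))

load-member : (w : Vector ℚ n) (X : Subset n) → load w (member X) ≡ weight w X
load-member w []          = refl
load-member w (true  ∷ X) = cong₂ ℚ._+_ (ℚ.+-identityʳ (w zero)) (load-member (tail w) X)
load-member w (false ∷ X) = cong (0ℚ ℚ.+_) (load-member (tail w) X)

load-const : (w : Vector ℚ n) (k : ℕ) → load w (λ _ → k) ≡ k · weight w ⊤
load-const {zero}  w zero    = refl
load-const {zero}  w (suc k) = trans (load-const w k) (sym (ℚ.+-identityˡ _))
load-const {suc n} w k       =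
  trans (cong (k · w zero ℚ.+_) (load-const (tail w) k)) (sym (×-distrib-+ (w zero) _ k))

load-occ-∷ : ∀ {k} (w : Vector ℚ n) (X : Subset n) (Xs : Vec (Subset n) k) →
  load w (occ (X ∷ Xs)) ≡ weight w X ℚ.+ load w (occ Xs)
load-occ-∷ w X Xs = trans (load-cong w (occ-∷ X Xs))
  (trans (load-+ w (member X) (occ Xs)) (cong (ℚ._+ load w (occ Xs)) (load-member w X)))

weight-∁ : (w : Vector ℚ n) (X : Subset n) → weight w X ℚ.+ weight w (∁ X) ≡ weight w ⊤
weight-∁ w []          = refl
weight-∁ w (true  ∷ X) = trans (interchange (w zero) (weight (tail w) X) 0ℚ (weight (tail w) (∁ X)))
                                  (cong₂ ℚ._+_ (ℚ.+-identityʳ (w zero)) (weight-∁ (tail w) X))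
weight-∁ w (false ∷ X) = trans (interchange 0ℚ (weight (tail w) X) (w zero) (weight (tail w) (∁ X)))
                                  (cong₂ ℚ._+_ (ℚ.+-identityˡ (w zero)) (weight-∁ (tail w) X))

weight-zero : (w : Vector ℚ n) → (∀ i → w i ≡ 0ℚ) → ∀ X → weight w X ≡ 0ℚ
weight-zero w w≡0 []          = refl
weight-zero w w≡0 (true  ∷ X) = cong₂ ℚ._+_ (w≡0 zero) (weight-zero (tail w) (w≡0 ∘ suc) X)
weight-zero w w≡0 (false ∷ X) = cong (0ℚ ℚ.+_) (weight-zero (tail w) (w≡0 ∘ suc) X)

weight-⊤-nonneg : (w : Vector ℚ n) → (∀ i → 0ℚ ℚ.≤ w i) → 0ℚ ℚ.≤ weight w ⊤
weight-⊤-nonneg {zero}  w w≥0 = ℚ.≤-refl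
weight-⊤-nonneg {suc n} w w≥0 = ℚ.+-mono-≤ (w≥0 zero) (weight-⊤-nonneg (tail w) (w≥0 ∘ suc))

w≤weight-⊤ : (w : Vector ℚ n) → (∀ i → 0ℚ ℚ.≤ w i) → ∀ i → w i ℚ.≤ weight w ⊤
w≤weight-⊤ w w≥0 zero    = subst (ℚ._≤ weight w ⊤) (ℚ.+-identityʳ (w zero))
  (ℚ.+-monoʳ-≤ (w zero) (weight-⊤-nonneg (tail w) (w≥0 ∘ suc)))
w≤weight-⊤ w w≥0 (suc i) = subst (ℚ._≤ weight w ⊤) (ℚ.+-identityˡ (w (suc i)))
  (ℚ.+-mono-≤ (w≥0 zero) (w≤weight-⊤ (tail w) (w≥0 ∘ suc) i))

-- From a rough weighting to the at-least-half property

module _ (G : SimpleGame n) where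
  open SimpleGame G

  winning∧losing⇒⊥ : ∀ {X} → Winning G X → ¬ Losing G X
  winning∧losing⇒⊥ X∈W X∉W with () ← trans (sym X∈W) X∉W

  -- Let T be the weight of all players. The sequence weighs at least kT, but at most kT - T if
  -- every player occurs fewer than k times. So T and all weights are 0, and then q = 0 because both
  -- winning and losing coalitions exist.
  roughlyWeighted⇒atLeastHalf : RoughlyWeighted G → ∀ k → AtLeastHalfFor G k
  roughlyWeighted⇒atLeastHalf (w , q , w≥0 , nonzero , light , heavy) k Xs Ys Xs-win Ys-block
    with any? (λ i → k ℕ.≤? occ Xs i ℕ.+ occ Ys i)
  ... | yes found = found
  ... | no  none  = contradiction (w≡0 , q≡0) nonzero
    where
    T = weight w ⊤

    q≤weight : ∀ {X} → Winning G X → q ℚ.≤ weight w X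
    q≤weight X∈W = ℚ.≮⇒≥ (winning∧losing⇒⊥ X∈W ∘ light _)

    weight≤q : ∀ {X} → Losing G X → weight w X ℚ.≤ q
    weight≤q X∉W = ℚ.≮⇒≥ (λ q<X → winning∧losing⇒⊥ (heavy _ q<X) X∉W)

    winning-load : ∀ {k} (Xs : Vec (Subset n) k) → Vec.All (Winning G) Xs → k · q ℚ.≤ load w (occ Xs)
    winning-load []       []       = ℚ.≤-reflexive (sym (load-const w 0))
    winning-load (X ∷ Xs) (h ∷ hs) = subst (_ ℚ.≤_) (sym (load-occ-∷ w X Xs)) (ℚ.+-mono-≤ (q≤weight h) (winning-load Xs hs))

    -- The complement of a blocking coalition weighs at most q, so the coalition weighs at least T -
    -- q; q is moved across to avoid subtraction.
    blocking-load : ∀ {k} (Ys : Vec (Subset n) k) → Vec.All (Blocking G) Ys → k · T ℚ.≤ load w (occ Ys) ℚ.+ k · q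
    blocking-load []       []       = ℚ.≤-reflexive (sym (trans (ℚ.+-identityʳ _) (load-const w 0)))
    blocking-load {suc k} (Y ∷ Ys) (h ∷ hs) = begin
      T ℚ.+ k · T                                          ≡⟨ cong (ℚ._+ k · T) (sym (weight-∁ w Y)) ⟩
      (weight w Y ℚ.+ weight w (∁ Y)) ℚ.+ k · T            ≤⟨ ℚ.+-mono-≤ (ℚ.+-monoʳ-≤ (weight w Y) (weight≤q h)) (blocking-load Ys hs) ⟩
      (weight w Y ℚ.+ q) ℚ.+ (load w (occ Ys) ℚ.+ k · q)   ≡⟨ interchange (weight w Y) q (load w (occ Ys)) (k · q) ⟩
      (weight w Y ℚ.+ load w (occ Ys)) ℚ.+ (q ℚ.+ k · q)   ≡⟨ cong (ℚ._+ (q ℚ.+ k · q)) (sym (load-occ-∷ w Y Ys)) ⟩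
      load w (occ (Y ∷ Ys)) ℚ.+ (q ℚ.+ k · q)              ∎
      where open ℚ.≤-Reasoning

    c : Fin n → ℕ
    c i = occ Xs i ℕ.+ occ Ys i

    total-lower : k · T ℚ.+ k · q ℚ.≤ load w c ℚ.+ k · q
    total-lower = begin
      k · T ℚ.+ k · q                                   ≡⟨ ℚ.+-comm (k · T) (k · q) ⟩
      k · q ℚ.+ k · T                                   ≤⟨ ℚ.+-mono-≤ (winning-load Xs Xs-win) (blocking-load Ys Ys-block) ⟩
      load w (occ Xs) ℚ.+ (load w (occ Ys) ℚ.+ k · q)   ≡⟨ sym (ℚ.+-assoc (load w (occ Xs)) (load w (occ Ys)) (k · q)) ⟩
      (load w (occ Xs) ℚ.+ load w (occ Ys)) ℚ.+ k · q   ≡⟨ cong (ℚ._+ k · q) (sym (load-+ w (occ Xs) (occ Ys))) ⟩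
      load w c ℚ.+ k · q                                ∎
      where open ℚ.≤-Reasoning

    -- T counts every player once more, which turns c i < k into c i + 1 ≤ k.
    total-upper : load w c ℚ.+ T ℚ.≤ k · T
    total-upper = begin
      load w c ℚ.+ T                  ≡⟨ cong (load w c ℚ.+_) (sym (trans (load-const w 1) (ℚ.+-identityʳ T))) ⟩
      load w c ℚ.+ load w (λ _ → 1)   ≡⟨ sym (load-+ w c (λ _ → 1)) ⟩
      load w (λ i → c i ℕ.+ 1)        ≤⟨ load-mono-≤ w≥0 (λ i → subst (ℕ._≤ k) (ℕ.+-comm 1 (c i)) (ℕ.≰⇒> (λ k≤c → none (i , k≤c)))) ⟩
      load w (λ _ → k)                ≡⟨ load-const w k ⟩
      k · T                           ∎
      where open ℚ.≤-Reasoning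

    T≤0 : T ℚ.≤ 0ℚ
    T≤0 = ℚ.≮⇒≥ λ 0<T → ℚ.<-irrefl refl (begin-strict
      load w c ℚ.+ k · q              ≡⟨ cong (ℚ._+ k · q) (sym (ℚ.+-identityʳ (load w c))) ⟩
      (load w c ℚ.+ 0ℚ) ℚ.+ k · q     <⟨ ℚ.+-monoˡ-< (k · q) (ℚ.+-monoʳ-< (load w c) 0<T) ⟩
      (load w c ℚ.+ T) ℚ.+ k · q      ≤⟨ ℚ.+-monoˡ-≤ (k · q) total-upper ⟩
      k · T ℚ.+ k · q                 ≤⟨ total-lower ⟩
      load w c ℚ.+ k · q              ∎)
      where open ℚ.≤-Reasoning

    w≡0 : ∀ i → w i ≡ 0ℚ
    w≡0 i = ℚ.≤-antisym (ℚ.≤-trans (w≤weight-⊤ w w≥0 i) T≤0) (w≥0 i)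

    q≡0 : q ≡ 0ℚ
    q≡0 = ℚ.≤-antisym
      (subst (q ℚ.≤_) (weight-zero w w≡0 _) (q≤weight (proj₂ nonEmpty)))
      (subst (ℚ._≤ q) (weight-zero w w≡0 _) (weight≤q (proj₂ notAll)))

-- Integer weights, enumeration of coalitions and bounds

fromℤ : ℤ → ℚ
-- The field 0 is the denominator minus one. With `mkℚ` the numerator computes to i, without a gcd.
fromℤ i = mkℚ i 0 (Coprimality.sym (Coprimality.1-coprimeTo ℤ.∣ i ∣))

fromℤ-+ : ∀ i j → fromℤ (i + j) ≡ fromℤ i ℚ.+ fromℤ j
fromℤ-+ i j = ℚ.toℚᵘ-injective (ℚᵘ.≃-sym (ℚᵘ.≃-trans (ℚ.toℚᵘ-homo-+ (fromℤ i) (fromℤ j)) (ℚᵘ.*≡* (step i j))))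
  where
  step : ∀ i j → (i * 1ℤ + j * 1ℤ) * 1ℤ ≡ (i + j) * 1ℤ
  step = solve-∀

fromℤ-mono-≤ : ∀ {i j} → i ≤ j → fromℤ i ℚ.≤ fromℤ j
fromℤ-mono-≤ i≤j = ℚ.*≤* (ℤ.*-monoʳ-≤-nonNeg 1ℤ i≤j)

indicator : Subset n → Vector ℤ n
indicator X i = + member X i

weight-fromℤ : (w : Vector ℤ n) (X : Subset n) → weight (fromℤ ∘ w) X ≡ fromℤ (dot w (indicator X))
weight-fromℤ w []          = refl
weight-fromℤ w (true  ∷ X) = trans (cong₂ ℚ._+_ (cong fromℤ (sym (ℤ.*-identityʳ (w zero)))) (weight-fromℤ (tail w) X))
                                   (sym (fromℤ-+ (w zero * 1ℤ) (dot (tail w) (indicator X))))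
weight-fromℤ w (false ∷ X) = trans (cong₂ ℚ._+_ (cong fromℤ (sym (ℤ.*-zeroʳ (w zero)))) (weight-fromℤ (tail w) X))
                                   (sym (fromℤ-+ (w zero * 0ℤ) (dot (tail w) (indicator X))))

dot-⊥ : (w : Vector ℤ n) → dot w (indicator ⊥) ≡ 0ℤ
dot-⊥ {zero}  w = refl
dot-⊥ {suc n} w = cong₂ _+_ (ℤ.*-zeroʳ (w zero)) (dot-⊥ (tail w))

dot-⁅⁆ : (w : Vector ℤ n) (i : Fin n) → dot w (indicator ⁅ i ⁆) ≡ w i
dot-⁅⁆ w zero    = trans (cong₂ _+_ (ℤ.*-identityʳ (w zero)) (dot-⊥ (tail w))) (ℤ.+-identityʳ (w zero))
dot-⁅⁆ w (suc i) = trans (cong₂ _+_ (ℤ.*-zeroʳ (w zero)) (dot-⁅⁆ (tail w) i)) (ℤ.+-identityˡ (w (suc i)))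

satisfying : {P : Subset n → Set} → (∀ X → Dec (P X)) → List (∃ P)
satisfying {zero}  P? with P? []
... | yes p = ([] , p) ∷ []
... | no  _ = []
satisfying {suc n} P? =
  map (λ (X , p) → false ∷ X , p) (satisfying (P? ∘ (false ∷_))) ++
  map (λ (X , p) → true ∷ X , p) (satisfying (P? ∘ (true ∷_)))

-- The list holds the proof found by `P?`, possibly different from the given one; hence the
-- existential.
satisfying-complete : {P : Subset n → Set} (P? : ∀ X → Dec (P X)) → ∀ X → P X →
  ∃ λ p → (X , p) ∈ satisfying P?
satisfying-complete P? [] p with P? []
... | yes p′ = p′ , here refl
... | no  ¬p = contradiction p ¬p
satisfying-complete P? (false ∷ X) p with satisfying-complete (P? ∘ (false ∷_)) X p
... | p′ , ∈l = p′ , ∈-++⁺ˡ (∈-map⁺ _ ∈l)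
satisfying-complete P? (true ∷ X) p with satisfying-complete (P? ∘ (true ∷_)) X p
... | p′ , ∈l = p′ , ∈-++⁺ʳ _ (∈-map⁺ _ ∈l)

dot≤n : (v : Vector ℤ n) → (∀ i → v i * v i ≤ 1ℤ) → dot v v ≤ + n
dot≤n {zero}  v v²≤1 = ℤ.≤-refl
dot≤n {suc n} v v²≤1 = ℤ.+-mono-≤ (v²≤1 zero) (dot≤n (tail v) (v²≤1 ∘ suc))

indicator-∁ : (X : Subset n) → ∀ i → indicator (∁ X) i ≡ 1ℤ - indicator X i
indicator-∁ X i rewrite Vec.lookup-map i not X with lookup X i
... | true  = refl
... | false = refl

∁-involutive : (X : Subset n) → ∁ (∁ X) ≡ X
∁-involutive X = trans (sym (Vec.map-∘ not not X)) (trans (Vec.map-cong not-involutive X) (Vec.map-id X))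

-- M is the largest entry, or 0 for the empty list: a natural number in the role of √C.
square-bound : ∀ C (xs : List ℕ) → All (λ x → x ℕ.* x ℕ.≤ C) xs → ∃ λ M → M ℕ.* M ℕ.≤ C × sum xs ℕ.≤ length xs ℕ.* M
square-bound C []       _                 = 0 , z≤n , z≤n
square-bound C (x ∷ xs) (x²≤C ∷ xs²≤C) with square-bound C xs xs²≤C
... | M , M²≤C , sum≤ with ℕ.≤-total x M
...   | inj₁ x≤M = M , M²≤C , ℕ.+-mono-≤ x≤M sum≤
...   | inj₂ M≤x = x , x²≤C , ℕ.+-monoʳ-≤ x (ℕ.≤-trans sum≤ (ℕ.*-monoʳ-≤ (length xs) M≤x))

-- From the at-least-half property to a rough weighting

module _ (G : SimpleGame n) where
  open SimpleGame G

  -- One index per constraint on w: a losing coalition does not outweigh a winning one, and each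
  -- weight is non-negative.
  Index : Set
  Index = (∃ (Winning G) × ∃ (Losing G)) ⊎ Fin n

  vector : Index → Vector ℤ n
  vector (inj₁ ((X , _) , (L , _))) i = indicator X i - indicator L i
  vector (inj₂ j)                     = indicator ⁅ j ⁆

  winningCoalitions : List (∃ (Winning G))
  winningCoalitions = satisfying (λ X → win X ≟ true)

  losingCoalitions : List (∃ (Losing G))
  losingCoalitions = satisfying (λ X → win X ≟ false)

  indices : List Index
  indices = map inj₁ (cartesianProduct winningCoalitions losingCoalitions) ++ map inj₂ (allFin n)

  -- A negative product with this vector says that the weights have a positive sum, which excludes w
  -- = 0.
  minusOne : Vector ℤ n
  minusOne _ = -1ℤ

  -- No losing coalition outweighs a winning one, so the least weight of a winning coalition can
  -- serve as quota.
  separated⇒roughlyWeighted : Separated vector indices minusOne → RoughlyWeighted G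
  separated⇒roughlyWeighted (w , w≥0 , w·-1<0) = fromℤ ∘ w , fromℤ q , fromℤ-mono-≤ ∘ nonneg , nonzero , light , heavy
    where
    nonneg : ∀ i → 0ℤ ≤ w i
    nonneg i = subst (0ℤ ≤_) (dot-⁅⁆ w i) (All.lookup w≥0 (∈-++⁺ʳ _ (∈-map⁺ inj₂ (∈-allFin i))))

    value : ∃ (Winning G) → ℤ
    value (X , _) = dot w (indicator X)

    -- The starting value `nonEmpty` is itself winning, so the minimum is attained by a winning
    -- coalition.
    lightest = argmin value nonEmpty winningCoalitions
    q = value lightest

    nonzero : ¬ ((∀ i → fromℤ (w i) ≡ 0ℚ) × fromℤ q ≡ 0ℚ)
    nonzero (w≡0 , _) = ℤ.<-irrefl refl (subst (_< 0ℤ)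
      (trans (dot-comm w minusOne) (trans (dot-congʳ minusOne (cong ℚ.↥_ ∘ w≡0)) (dot-zeroʳ minusOne))) w·-1<0)

    q≤winning : ∀ X → Winning G X → q ≤ dot w (indicator X)
    q≤winning X X∈W = All.lookup (f[argmin]≤f[xs] {f = value} nonEmpty winningCoalitions) (proj₂ (satisfying-complete _ X X∈W))

    minus : ∀ x y → x - y ≡ 1ℤ * x + -1ℤ * y
    minus = solve-∀

    losing≤winning : ∀ X L → Winning G X → Losing G L → dot w (indicator L) ≤ dot w (indicator X)
    losing≤winning X L X∈W L∉W
      with pX , X∈ ← satisfying-complete (λ X → win X ≟ true) X X∈W
         | pL , L∈ ← satisfying-complete (λ X → win X ≟ false) L L∉W =
      ℤ.0≤i-j⇒j≤i (subst (0ℤ ≤_) w·[X-L]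
        (All.lookup w≥0 (∈-++⁺ˡ (∈-map⁺ inj₁ (∈-cartesianProduct⁺ X∈ L∈)))))
      where
      w·[X-L] : dot w (λ i → indicator X i - indicator L i) ≡ dot w (indicator X) - dot w (indicator L)
      w·[X-L] = trans (dot-congʳ w (λ i → minus (indicator X i) (indicator L i)))
               (trans (dot-linearʳ w 1ℤ (indicator X) -1ℤ (indicator L)) (sym (minus (dot w (indicator X)) (dot w (indicator L)))))

    light : ∀ X → weight (fromℤ ∘ w) X ℚ.< fromℤ q → Losing G X
    light X X<q with win X in eq
    ... | false = refl
    ... | true  = contradiction
      (ℚ.<-≤-trans X<q (subst (fromℤ q ℚ.≤_) (sym (weight-fromℤ w X)) (fromℤ-mono-≤ (q≤winning X eq))))
      (ℚ.<-irrefl refl)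

    heavy : ∀ X → weight (fromℤ ∘ w) X ℚ.> fromℤ q → Winning G X
    heavy X q<X with win X in eq
    ... | true  = refl
    ... | false = contradiction
      (ℚ.<-≤-trans q<X (subst (ℚ._≤ fromℤ q) (sym (weight-fromℤ w X))
        (fromℤ-mono-≤ (losing≤winning (proj₁ lightest) X (proj₂ lightest) eq))))
      (ℚ.<-irrefl refl)

  -- A negative `excess i` means that player i occurs in fewer than half of the coalitions.
  -- `excess≥` is an inequality because unit vectors raise the excess without adding coalitions.
  record ELSequence (bound : ℕ) (excess : Vector ℤ n) : Set where
    field
      degree   : ℕ
      Xs Ys    : Vec (Subset n) degree
      winning  : Vec.All (Winning G) Xs
      blocking : Vec.All (Blocking G) Ys
      degree≤  : degree ℕ.≤ bound
      excess≥  : ∀ i → + (occ Xs i ℕ.+ occ Ys i) ≤ + degree + excess i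

  -- Player i occurs in X and `∁ L` together 1 + (X - L)ᵢ times. Each copy of the pair thus adds 1
  -- to the degree and X - L to the excess.
  addPairs : ∀ {bound excess} c (p : ∃ (Winning G) × ∃ (Losing G)) → ELSequence bound excess →
    ELSequence (c ℕ.+ bound) (λ i → + c * vector (inj₁ p) i + excess i)
  addPairs {_} {excess} zero p e = record
    { ELSequence e ; excess≥ = λ i → subst (λ x → + (occ Xs i ℕ.+ occ Ys i) ≤ + degree + x) (sym (ℤ.+-identityˡ (excess i))) (excess≥ i) }
    where open ELSequence e
  addPairs {_} {excess} (suc c) p@((X , X∈W) , (L , L∉W)) e = record
    { degree   = suc degree
    ; Xs       = X ∷ Xs
    ; Ys       = ∁ L ∷ Ys
    ; winning  = X∈W ∷ winning
    ; blocking = subst (Losing G) (sym (∁-involutive L)) L∉W ∷ blocking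
    ; degree≤  = s≤s degree≤
    ; excess≥  = λ i → begin
        + (occ (X ∷ Xs) i ℕ.+ occ (∁ L ∷ Ys) i)
          ≡⟨ cong₂ (λ x y → + (x ℕ.+ y)) (occ-∷ X Xs i) (occ-∷ (∁ L) Ys i) ⟩
        + ((member X i ℕ.+ occ Xs i) ℕ.+ (member (∁ L) i ℕ.+ occ Ys i))
          ≡⟨ cong +_ (rearrange (member X i) (occ Xs i) (member (∁ L) i) (occ Ys i)) ⟩
        indicator X i + indicator (∁ L) i + + (occ Xs i ℕ.+ occ Ys i)
          ≤⟨ ℤ.+-monoʳ-≤ (indicator X i + indicator (∁ L) i) (excess≥ i) ⟩
        indicator X i + indicator (∁ L) i + (+ degree + (+ c * vector (inj₁ p) i + excess i))
          ≡⟨ cong (λ l → indicator X i + l + (+ degree + (+ c * vector (inj₁ p) i + excess i))) (indicator-∁ L i) ⟩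
        indicator X i + (1ℤ - indicator L i) + (+ degree + (+ c * vector (inj₁ p) i + excess i))
          ≡⟨ collect (indicator X i) (indicator L i) (+ degree) (+ c) (excess i) ⟩
        + suc degree + (+ suc c * vector (inj₁ p) i + excess i) ∎
    }
    where
    open ELSequence (addPairs c p e)
    open ℤ.≤-Reasoning
    rearrange : ∀ a b c d → (a ℕ.+ b) ℕ.+ (c ℕ.+ d) ≡ (a ℕ.+ c) ℕ.+ (b ℕ.+ d)
    rearrange = solveℕ-∀
    collect : ∀ x l d c r → x + (1ℤ - l) + (d + (c * (x - l) + r)) ≡ (1ℤ + d) + ((1ℤ + c) * (x - l) + r)
    collect = solve-∀

  elSequence : ∀ ps → ELSequence (sum (map proj₁ ps)) (combination vector ps)
  elSequence []                  = record
    { degree = 0 ; Xs = [] ; Ys = [] ; winning = [] ; blocking = [] ; degree≤ = z≤n ; excess≥ = λ i → ℤ.≤-refl }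
  elSequence ((c , inj₁ p) ∷ ps) = addPairs c p (elSequence ps)
  -- A unit vector contributes no coalition; its non-negative term only weakens both bounds.
  elSequence ((c , inj₂ j) ∷ ps) = record
    { ELSequence (elSequence ps)
    ; degree≤ = ℕ.≤-trans degree≤ (ℕ.m≤n+m _ c)
    ; excess≥ = λ i → ℤ.≤-trans (excess≥ i) (ℤ.+-monoʳ-≤ (+ degree)
        (subst (_≤ + c * vector (inj₂ j) i + combination vector ps i) (ℤ.+-identityˡ (combination vector ps i))
          (ℤ.+-monoˡ-≤ (combination vector ps i) (subst (0ℤ ≤_) (ℤ.pos-* c (member ⁅ j ⁆ i)) (+≤+ z≤n)))))
    }
    where open ELSequence (elSequence ps)

  vector²≤1 : ∀ p i → vector p i * vector p i ≤ 1ℤ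
  vector²≤1 (inj₁ ((X , _) , (L , _))) i with lookup X i | lookup L i
  ... | true  | true  = +≤+ z≤n
  ... | true  | false = ℤ.≤-refl
  ... | false | true  = ℤ.≤-refl
  ... | false | false = +≤+ z≤n
  vector²≤1 (inj₂ j) i with lookup ⁅ j ⁆ i
  ... | true  = ℤ.≤-refl
  ... | false = +≤+ z≤n

  -- The excess of the sequence built from the combination is a negative constant, so no player
  -- reaches half of the coalitions.
  smallConeCombination⇒⊥ : AtLeastHalfTheoremDegree G → ¬ SmallConeCombination vector minusOne n
  smallConeCombination⇒⊥ half cone = ℤ.<-irrefl refl (begin-strict
      + degree                                 ≤⟨ +≤+ often ⟩
      + (occ Xs i ℕ.+ occ Ys i)                ≤⟨ excess≥ i ⟩
      + degree + combination vector terms i    ≡⟨ cong (λ x → + degree + x) (sym (equation i)) ⟩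
      + degree + + suc multiple-1 * -1ℤ        <⟨ ℤ.+-monoʳ-< (+ degree) -<+ ⟩
      + degree + 0ℤ                            ≡⟨ ℤ.+-identityʳ (+ degree) ⟩
      + degree                                 ∎)
    where
    open SmallConeCombination cone
    open ELSequence (elSequence terms)
    within : WithinTheoremDegree n degree
    within with square-bound (n ^ n) (map proj₁ terms) (All.map⁺ small)
    ... | M , M²≤ , sum≤ = let open ℕ.≤-Reasoning in begin
      degree ℕ.* degree                        ≤⟨ ℕ.*-mono-≤ degree≤nM degree≤nM ⟩
      (suc n ℕ.* M) ℕ.* (suc n ℕ.* M)          ≡⟨ ℕ.[m*n]*[o*p]≡[m*o]*[n*p] (suc n) M (suc n) M ⟩
      (suc n ℕ.* suc n) ℕ.* (M ℕ.* M)          ≤⟨ ℕ.*-monoʳ-≤ (suc n ℕ.* suc n) M²≤ ⟩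
      (suc n ℕ.* suc n) ℕ.* n ^ n              ∎
      where
      -- At most n coefficients, each at most M, give n M, which is weakened to the factor n + 1 of
      -- the theorem.
      degree≤nM : degree ℕ.≤ suc n ℕ.* M
      degree≤nM = ℕ.≤-trans degree≤ (ℕ.≤-trans sum≤ (ℕ.*-monoˡ-≤ M
        (ℕ.≤-trans (ℕ.≤-reflexive (length-map proj₁ terms)) (ℕ.m≤n⇒m≤1+n short))))
    witness = half degree within Xs Ys winning blocking
    i = proj₁ witness
    often = proj₂ witness
    open ℤ.≤-Reasoning

  atLeastHalf⇒roughlyWeighted : .{{ℕ.NonZero n}} → AtLeastHalfTheoremDegree G → RoughlyWeighted G
  atLeastHalf⇒roughlyWeighted half with farkas vector indices minusOne
  ... | inj₁ separated = separated⇒roughlyWeighted separated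
  ... | inj₂ cone      = contradiction
    (smallConeCombination vector indices minusOne n (λ p → dot≤n (vector p) (vector²≤1 p)) (dot≤n minusOne (λ _ → ℤ.≤-refl)) cone)
    (smallConeCombination⇒⊥ half)

-- The only coalition would be both winning and losing.
noPlayers⇒⊥ : ¬ SimpleGame 0
noPlayers⇒⊥ G with SimpleGame.nonEmpty G | SimpleGame.notAll G
... | [] , []∈W | [] , []∉W = winning∧losing⇒⊥ G {[]} []∈W []∉W

theorem9 : (n : ℕ) (G : SimpleGame n) →
    (RoughlyWeighted G → AtLeastHalfTheoremDegree G) × (AtLeastHalfTheoremDegree G → RoughlyWeighted G)
theorem9 zero    G = contradiction G noPlayers⇒⊥
theorem9 (suc n) G = (λ weighted k _ → roughlyWeighted⇒atLeastHalf G weighted k) , atLeastHalf⇒roughlyWeighted G
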